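{- Let $A\in\mathbb{Z}^{m\times s}$ be saturated with columns $F_1,\dots,F_s$, and let $I_{\mathcal{P}_A}$ be the toric ideal of $\mathcal{P}_A$ in the polynomial ring $\mathbb{K}[z,x_{F_1^+},x_{F_1^- },\dots,x_{F_s^+},x_{F_s^- }]$ equipped with the degree reverse lexicographic order induced by $z\prec x_{F_1^+}\prec x_{F_1^- }\prec\cdots\prec x_{F_s^+}\prec x_{F_s^- }$. Then the following binomials form a Gröbner basis of $I_{\mathcal{P}_A}$, and in each binomial as written the first monomial (with positive sign) is the initial term: (1) For every minimal linear dependency $\mathbf{a}$ with $|M_{\mathbf{a}}|=2k$ and every $k$-element submultiset $M\subseteq M_{\mathbf{a}}$ such that (a) $+F_{\min(\mathbf{a})}\notin M$ if $\mathbf{a}_{\min(\mathbf{a})}>0$, and (b) the multiset consisting of $-F_{\min(\mathbf{a})}$ with multiplicity $|\mathbf{a}_{\min(\mathbf{a})}|$ is not contained in $M$ if $\mathbf{a}_{\min(\mathbf{a})}<0$: the binomial $\prod_{F\in M}x_F-\prod_{F\in M_{\mathbf{a}}\setminus M}x_{\overline F}$. (2) For every minimal linear dependency $\mathbf{a}$ with $|M_{\mathbf{a}}|=2k+1$ and every $(k+1)$-element submultiset $M\subseteq M_{\mathbf{a}}$: $\prod_{F\in M}x_F-z\prod_{F\in M_{\mathbf{a}}\setminus M}x_{\overline F}$. (3) For every minimal linear dependency $\mathbf{a}$ with $|M_{\mathbf{a}}|=2k$ and every $(k+1)$-element submultiset $M\subseteq M_{\mathbf{a}}$ containing $+F_{\min(\mathbf{a})}$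 at least twice: $\prod_{F\in M}x_F-z^2\prod_{F\in M_{\mathbf{a}}\setminus M}x_{\overline F}$. (4) For every $i\in[s]$: $x_{F_i^+}x_{F_i^- }-z^2$.
   Context: For $A\in\mathbb{Z}^{m\times s}$, $\mathcal{P}_A=\operatorname{conv}$ of the columns of $A$ and $-A$. $A$ is saturated if every lattice point of $\mathcal{P}_A$ other than the origin occurs exactly once as a column of the matrix $[A\,|\,-A]$. The toric ideal: with one variable $x_\alpha$ per lattice point $\alpha\in\mathcal{P}_A\cap\mathbb{Z}^m$, $I_{\mathcal{P}_A}$ is the kernel of $x_\alpha\mapsto t^\alpha s$ into $\mathbb{K}[t_1^{\pm1},\dots,t_m^{\pm1},s]$; here $z$ is the variable of the origin, $x_{F_i^+}$ that of $F_i$ and $x_{F_i^- }$ that of $-F_i$. Degrevlex with $y_1\prec\dots\prec y_N$: $y^\alpha\prec y^\beta$ iff $\sum\alpha_i<\sum\beta_i$, or the sums are equal and $\alpha_\ell>\beta_\ell$ for $\ell=\min\{j:\alpha_j\ne\beta_j\}$. A minimal linear dependency is a nonzero $\mathbf{a}\in\ker_{\mathbb{Z}}A$ such that no $\mathbf{a}'\in\ker_{\mathbb{Z}}A$, $\mathbf{a}'\ne\mathbf{a}$, satisfies $\operatorname{sign}(\mathbf{a}'_i)=\operatorname{sign}(\mathbf{a}_i)$ and $|\mathbf{a}'_i|\le|\mathbf{a}_i|$ for all $i$. $M_{\mathbf{a}}$ is the multiset of signed columns containing $\operatorname{sign}(\mathbf{a}_\ell)F_\ell$ with multiplicity $|\mathbf{a}_\ell|$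 for each $\ell$ in the support of $\mathbf{a}$ (so $|M_{\mathbf{a}}|=\sum|\mathbf{a}_\ell|$); $\min(\mathbf{a})$ is the smallest index in the support of $\mathbf{a}$. For a signed column, $x_{+F_i}:=x_{F_i^+}$, $x_{ -F_i}:=x_{F_i^- }$, and $\overline{\pm F_i}:=\mp F_i$. A Gröbner basis is a generating set whose initial terms generate the initial ideal. -}

module Defs where

open import Level using (Level; _⊔_) renaming (suc to lsuc)
open import Algebra.Bundles using (CommutativeRing)
open import Data.Nat as ℕ using (ℕ; zero; suc)
open import Data.Integer as ℤ using (ℤ; +_; -[1+_]; +[1+_]; ∣_∣)
import Data.Integer.Properties as ℤP
import Data.Nat.Properties as ℕP
open import Data.Fin as Fin using (Fin)
open import Data.List as List using (List; []; _∷_; _++_)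
import Data.List.Properties as ListP
open import Data.Nat.ListAction using () renaming (sum to sumL)
open import Data.List.Relation.Unary.All using (All)
open import Data.Vec as Vec using (Vec)
import Data.Vec.Properties as VecP
open import Data.Product using (Σ; ∃; ∃₂; _×_; _,_; proj₁; proj₂)
import Data.Product.Properties as ProdP
open import Data.Sum using (_⊎_; inj₁; inj₂)
open import Data.Empty using (⊥)
open import Relation.Nullary using (¬_; yes; no)
open import Relation.Binary.PropositionalEquality using (_≡_; _≢_)
open import Relation.Binary.Definitions using (DecidableEquality)

record Field (c ℓ : Level) : Set (lsuc (c ⊔ ℓ)) where
  field
    commutativeRing : CommutativeRing c ℓ
  open CommutativeRing commutativeRing public
  field
    0≉1 : ¬ (0# ≈ 1#)
    inverse : ∀ x → ¬ (x ≈ 0#) → ∃ λ y → (x * y) ≈ 1#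

sumℕ : ∀ {n} → (Fin n → ℕ) → ℕ
sumℕ {zero} f = 0
sumℕ {suc n} f = f Fin.zero ℕ.+ sumℕ (λ i → f (Fin.suc i))

sumℤ : ∀ {n} → (Fin n → ℤ) → ℤ
sumℤ {zero} f = + 0
sumℤ {suc n} f = f Fin.zero ℤ.+ sumℤ (λ i → f (Fin.suc i))

Matrix : ℕ → ℕ → Set
Matrix m s = Fin m → Fin s → ℤ

colPM : ∀ {m s} → Matrix m s → Fin s ⊎ Fin s → Fin m → ℤ
colPM A (inj₁ j) r = A r j
colPM A (inj₂ j) r = ℤ.- A r j

-- α (a lattice point) lies in P_A = conv(±F_j): α is a convex combination
-- with rational weights, written with a common denominator N = Σ λ⁺ + Σ λ⁻ > 0:
-- N α = Σ_j λ⁺_j F_j + λ⁻_j (-F_j).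
InConvHull : ∀ {m s} → Matrix m s → (Fin m → ℤ) → Set
InConvHull {m} {s} A α =
  ∃₂ λ (l⁺ l⁻ : Fin s → ℕ) →
    (1 ℕ.≤ sumℕ l⁺ ℕ.+ sumℕ l⁻) ×
    (∀ r → (+ (sumℕ l⁺ ℕ.+ sumℕ l⁻)) ℤ.* α r
             ≡ sumℤ (λ j → ((+ l⁺ j) ℤ.- (+ l⁻ j)) ℤ.* A r j))

Saturated : ∀ {m s} → Matrix m s → Set
Saturated {m} {s} A =
  ∀ (α : Fin m → ℤ) → InConvHull A α → ¬ (∀ r → α r ≡ + 0) →
    Σ (Fin s ⊎ Fin s) λ c →
      (∀ r → colPM A c r ≡ α r) ×
      (∀ c' → (∀ r → colPM A c' r ≡ α r) → c' ≡ c)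

InKer : ∀ {m s} → Matrix m s → (Fin s → ℤ) → Set
InKer A a = ∀ r → sumℤ (λ j → A r j ℤ.* a j) ≡ + 0

sgn : ℤ → ℤ
sgn (+ zero) = + 0
sgn +[1+ _ ] = + 1
sgn -[1+ _ ] = ℤ.- (+ 1)

MinLinDep : ∀ {m s} → Matrix m s → (Fin s → ℤ) → Set
MinLinDep {m} {s} A a =
  InKer A a × ¬ (∀ i → a i ≡ + 0) ×
  (∀ (a' : Fin s → ℤ) → InKer A a' →
     (∀ i → (sgn (a' i) ≡ sgn (a i)) × (∣ a' i ∣ ℕ.≤ ∣ a i ∣)) →
     ∀ i → a' i ≡ a i)

IsMinIndex : ∀ {s} → (Fin s → ℤ) → Fin s → Set
IsMinIndex a i = (a i ≢ + 0) × (∀ j → a j ≢ + 0 → i Fin.≤ j)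

sizeM : ∀ {s} → (Fin s → ℤ) → ℕ
sizeM a = sumℕ (λ i → ∣ a i ∣)

-- A submultiset M ⊆ M_a is given by multiplicities μ_i ≤ |a_i| of the
-- signed column sign(a_i) F_i; |M| = Σ μ_i.
SubMS : ∀ {s} → (Fin s → ℤ) → (Fin s → ℕ) → Set
SubMS a μ = ∀ i → μ i ℕ.≤ ∣ a i ∣

data Var (s : ℕ) : Set where
  zv : Var s
  pv : Fin s → Var s
  mv : Fin s → Var s

-- all variables, listed in increasing order
vars : ∀ s → List (Var s)
vars s = zv ∷ List.concatMap (λ i → pv i ∷ mv i ∷ []) (List.allFin s)

Mon : ℕ → Set
Mon s = Var s → ℕ

expList : ∀ {s} → Mon s → List ℕ
expList {s} e = List.map e (vars s)

mulMon : ∀ {s} → Mon s → Mon s → Mon s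
mulMon e e' v = e v ℕ.+ e' v

_≺rev_ : List ℕ → List ℕ → Set
[] ≺rev _ = ⊥
(_ ∷ _) ≺rev [] = ⊥
(a ∷ as) ≺rev (b ∷ bs) = (b ℕ.< a) ⊎ ((a ≡ b) × (as ≺rev bs))

_≺_ : ∀ {s} → Mon s → Mon s → Set
e ≺ e' = (sumL (expList e) ℕ.< sumL (expList e'))
       ⊎ ((sumL (expList e) ≡ sumL (expList e')) × (expList e ≺rev expList e'))

module _ {c ℓ} (K : Field c ℓ) where
  open Field K

  coeffGen : ∀ {X E : Set} → DecidableEquality E → (X → E) →
             List (Carrier × X) → E → Carrier
  coeffGen _≟_ key [] e = 0#
  coeffGen _≟_ key ((a , x) ∷ p) e with key x ≟ e
  ... | yes _ = a + coeffGen _≟_ key p e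
  ... | no _ = coeffGen _≟_ key p e

  Poly : ℕ → Set c
  Poly s = List (Carrier × Mon s)

  coeff : ∀ {s} → Poly s → Mon s → Carrier
  coeff p e = coeffGen (ListP.≡-dec ℕP._≟_) expList p (expList e)

  _≈P_ : ∀ {s} → Poly s → Poly s → Set ℓ
  p ≈P q = ∀ e → coeff p e ≈ coeff q e

  _*P_ : ∀ {s} → Poly s → Poly s → Poly s
  p *P q = List.concatMap (λ t → List.map (λ t' → (proj₁ t * proj₁ t' , mulMon (proj₂ t) (proj₂ t'))) q) p

  monomial : ∀ {s} → Mon s → Poly s
  monomial e = (1# , e) ∷ []

  binom : ∀ {s} → Mon s → Mon s → Poly s
  binom u v = (1# , u) ∷ (- 1# , v) ∷ []

  InIdeal : ∀ {s p} → (Poly s → Set p) → Poly s → Set (c ⊔ ℓ ⊔ p)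
  InIdeal {s} G f =
    Σ (List (Poly s × Poly s)) λ L →
      All (λ hg → G (proj₂ hg)) L ×
      (f ≈P List.foldr (λ hg acc → (proj₁ hg *P proj₂ hg) ++ acc) [] L)

  IsInitial : ∀ {s} → Poly s → Mon s → Set ℓ
  IsInitial f e = ¬ (coeff f e ≈ 0#) ×
    (∀ e' → ¬ (coeff f e' ≈ 0#) → (expList e' ≡ expList e) ⊎ (e' ≺ e))

  InitSet : ∀ {s p} → (Poly s → Set p) → Poly s → Set (c ⊔ ℓ ⊔ p)
  InitSet {s} G q = Σ (Poly s) λ g → Σ (Mon s) λ e → G g × IsInitial g e × (q ≡ monomial e)

  IsGroebnerBasis : ∀ {s p q} → (Poly s → Set p) → (Poly s → Set q) → Set (c ⊔ ℓ ⊔ p ⊔ q)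
  IsGroebnerBasis I G =
    (∀ g → G g → I g) ×
    (∀ f → I f → InIdeal G f) ×
    (∀ f e → I f → IsInitial f e → InIdeal (InitSet G) (monomial e))

  -- The toric ideal I_{P_A}: kernel of  z ↦ s,  x_{F_i^+} ↦ t^{F_i} s,
  -- x_{F_i^-} ↦ t^{-F_i} s  into K[t^{±1}, s]; a monomial x^e maps to
  -- t^w s^d, and f is in the kernel iff every coefficient of its image is 0.

  toricImg : ∀ {m s} → Matrix m s → Mon s → Vec ℤ m × ℕ
  toricImg A e =
    Vec.tabulate (λ r → sumℤ (λ i → ((+ e (pv i)) ℤ.- (+ e (mv i))) ℤ.* A r i)) ,
    sumL (expList e)

  ToricIdeal : ∀ {m s} → Matrix m s → Poly s → Set ℓ
  ToricIdeal {m} {s} A f =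
    ∀ (w : Vec ℤ m × ℕ) →
      coeffGen (ProdP.≡-dec (VecP.≡-dec ℤP._≟_) ℕP._≟_) (toricImg A) f w ≈ 0#

  ifPos : ℤ → ℕ → ℕ
  ifPos +[1+ _ ] n = n
  ifPos _ n = 0

  ifNeg : ℤ → ℕ → ℕ
  ifNeg -[1+ _ ] n = n
  ifNeg _ n = 0

  monM : ∀ {s} → (Fin s → ℤ) → (Fin s → ℕ) → Mon s
  monM a μ zv = 0
  monM a μ (pv i) = ifPos (a i) (μ i)
  monM a μ (mv i) = ifNeg (a i) (μ i)

  monC : ∀ {s} → (Fin s → ℤ) → (Fin s → ℕ) → ℕ → Mon s
  monC a μ d zv = d
  monC a μ d (pv i) = ifNeg (a i) (∣ a i ∣ ℕ.∸ μ i)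
  monC a μ d (mv i) = ifPos (a i) (∣ a i ∣ ℕ.∸ μ i)

  monPM : ∀ {s} → Fin s → Mon s
  monPM i zv = 0
  monPM i (pv j) with i Fin.≟ j
  ... | yes _ = 1
  ... | no _ = 0
  monPM i (mv j) with i Fin.≟ j
  ... | yes _ = 1
  ... | no _ = 0

  monZ2 : ∀ {s} → Mon s
  monZ2 zv = 2
  monZ2 (pv _) = 0
  monZ2 (mv _) = 0

  Gen1 : ∀ {m s} → Matrix m s → Poly s → Set c
  Gen1 {m} {s} A p =
    Σ (Fin s → ℤ) λ a → MinLinDep A a × Σ (Fin s) λ i → IsMinIndex a i ×
    Σ ℕ λ k → (sizeM a ≡ 2 ℕ.* k) ×
    Σ (Fin s → ℕ) λ μ → SubMS a μ × (sumℕ μ ≡ k) ×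
      ((+ 0 ℤ.< a i) → μ i ≡ 0) ×
      ((a i ℤ.< + 0) → ¬ (∣ a i ∣ ℕ.≤ μ i)) ×
      (p ≡ binom (monM a μ) (monC a μ 0))

  Gen2 : ∀ {m s} → Matrix m s → Poly s → Set c
  Gen2 {m} {s} A p =
    Σ (Fin s → ℤ) λ a → MinLinDep A a ×
    Σ ℕ λ k → (sizeM a ≡ 2 ℕ.* k ℕ.+ 1) ×
    Σ (Fin s → ℕ) λ μ → SubMS a μ × (sumℕ μ ≡ k ℕ.+ 1) ×
      (p ≡ binom (monM a μ) (monC a μ 1))

  Gen3 : ∀ {m s} → Matrix m s → Poly s → Set c
  Gen3 {m} {s} A p =
    Σ (Fin s → ℤ) λ a → MinLinDep A a × Σ (Fin s) λ i → IsMinIndex a i ×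
    Σ ℕ λ k → (sizeM a ≡ 2 ℕ.* k) ×
    Σ (Fin s → ℕ) λ μ → SubMS a μ × (sumℕ μ ≡ k ℕ.+ 1) ×
      (+ 0 ℤ.< a i) × (2 ℕ.≤ μ i) ×
      (p ≡ binom (monM a μ) (monC a μ 2))

  Gen4 : ∀ {m s} → Matrix m s → Poly s → Set c
  Gen4 {m} {s} A p = Σ (Fin s) λ i → p ≡ binom (monPM i) monZ2

  Gens : ∀ {m s} → Matrix m s → Poly s → Set c
  Gens A p = Gen1 A p ⊎ Gen2 A p ⊎ Gen3 A p ⊎ Gen4 A p

-- Let v ≺ u be monomials with the same image; some listed initial term must divide u.  If u has a
-- factor x₊x₋ this is (4).  Otherwise the difference w of the exponent vectors of u and v lies in
-- ker A, and u contains a share μ of w.  Comparing degrees gives |w| ≤ 2|μ|; in the case of equality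
-- the reverse lexicographic tie-break shows that μ misses part of w at the smallest index of its
-- support.  Splitting w into sign-compatible pieces, one piece that is a minimal dependency inherits
-- this property, and cutting its share of μ down to the prescribed size gives the initial term of a
-- binomial (1), (2) or (3).  Hence any two monomials with the same image are congruent modulo the
-- binomials, and the initial term of an element of the toric ideal is never the smallest monomial of
-- its fiber.

module Submission where

open import Defs
open import Level using (_⊔_)
open import Data.Nat as ℕ using (ℕ; zero; suc; _+_; _*_; _∸_; _⊓_; _^_; _≤_; _<_; z≤n; s≤s; _≤?_; _<?_)
open import Data.Nat.Properties
open import Data.Nat.Tactic.RingSolver using (solve-∀)
open import Data.Nat.ListAction using () renaming (sum to sumL)
open import Data.Integer as ℤ using (ℤ; +_; -[1+_]; +[1+_]; ∣_∣)
import Data.Integer.Properties as ℤP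
import Data.Integer.Tactic.RingSolver as ℤSolver
open import Data.Fin as Fin using (Fin)
import Data.Fin.Properties as FinP
open import Data.List as List using (List; []; _∷_; _++_)
import Data.List.Properties as ListP
open import Data.Vec as Vec using (Vec)
import Data.Product.Properties as ProdP
import Data.Vec.Properties as VecP
open import Data.Product using (Σ; ∃; _×_; _,_; proj₁; proj₂)
open import Data.Sum using (_⊎_; inj₁; inj₂; swap)
open import Data.List.Relation.Unary.Any as Any using (Any; here; there; any?)
open import Data.List.Membership.Propositional using (_∈_; find; lose)
open import Data.List.Membership.Propositional.Properties using (∈-map⁺; ∈-upTo⁺)
open import Data.List.Relation.Unary.All using (All; []; _∷_)
import Data.List.Relation.Unary.All.Properties as AllP
import Algebra.Properties.Ring as RingProperties
import Algebra.Properties.CommutativeSemigroup as CommutativeSemigroupProperties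
open import Data.Empty using (⊥-elim)
open import Function using (_∘_; id)
open import Relation.Nullary using (¬_; Dec; yes; no; contradiction)
open import Relation.Nullary.Decidable using (_×-dec_; _⊎-dec_; ¬?)
open import Relation.Binary.Definitions using (DecidableEquality; tri<; tri≈; tri>)
open import Relation.Binary.PropositionalEquality
  using (_≡_; _≢_; _≗_; refl; sym; trans; cong; cong₂; subst; subst₂)

open CommutativeSemigroupProperties +-commutativeSemigroup
  using () renaming (interchange to +-interchange)

-- Why |w| ≤ 2|μ|: at an index where u has no factor x₊x₋, every unit of w is paid for either by a
-- variable of u, counted by μ, or by the opposite variable of v. So the degree of u there exceeds
-- that of v by at most 2μ_i - |w_i|. Since v ≺ u in equal total degree, v contains at least as much
-- z, so the remaining variables of u have at least the degree of those of v; summing over the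
-- indices gives the bound, strictly if the z-exponents differ. Both sides of the bound are additive
-- under splitting w and μ, which is why one piece inherits the property. The tie-break is attached
-- to one fixed index of the original w, because the pieces may have smaller supports. Equality in
-- the field is not assumed decidable. The argument about initial terms therefore runs under double
-- negation until it reaches a claim about the listed terms of the polynomial, which is decidable.

-- Finite sums and the integer kernel of a matrix.

sumℕ-cong : ∀ {n} {f g : Fin n → ℕ} → f ≗ g → sumℕ f ≡ sumℕ g
sumℕ-cong {zero} f≗g = refl
sumℕ-cong {suc n} f≗g = cong₂ _+_ (f≗g Fin.zero) (sumℕ-cong (f≗g ∘ Fin.suc))

sumℕ-+ : ∀ {n} (f g : Fin n → ℕ) → sumℕ (λ i → f i + g i) ≡ sumℕ f + sumℕ g
sumℕ-+ {zero} f g = refl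
sumℕ-+ {suc n} f g =
  trans (cong ((f Fin.zero + g Fin.zero) ℕ.+_) (sumℕ-+ (f ∘ Fin.suc) (g ∘ Fin.suc)))
        (+-interchange (f Fin.zero) _ _ _)

sumℕ-double : ∀ {n} (f : Fin n → ℕ) → sumℕ (λ i → 2 * f i) ≡ 2 * sumℕ f
sumℕ-double {zero} f = refl
sumℕ-double {suc n} f = trans (cong (2 * f Fin.zero ℕ.+_) (sumℕ-double (f ∘ Fin.suc)))
                              (sym (*-distribˡ-+ 2 (f Fin.zero) _))

sumℕ-mono : ∀ {n} {f g : Fin n → ℕ} → (∀ i → f i ≤ g i) → sumℕ f ≤ sumℕ g
sumℕ-mono {zero} f≤g = z≤n
sumℕ-mono {suc n} f≤g = +-mono-≤ (f≤g Fin.zero) (sumℕ-mono (f≤g ∘ Fin.suc))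

sumℕ-zero : ∀ n → sumℕ {n} (λ _ → 0) ≡ 0
sumℕ-zero zero = refl
sumℕ-zero (suc n) = sumℕ-zero n

term≤sumℕ : ∀ {n} (f : Fin n → ℕ) i → f i ≤ sumℕ f
term≤sumℕ f Fin.zero = m≤m+n _ _
term≤sumℕ f (Fin.suc i) = ≤-trans (term≤sumℕ (f ∘ Fin.suc) i) (m≤n+m _ _)

sumℕ-≤-tight : ∀ {n} {f g : Fin n → ℕ} → (∀ i → f i ≤ g i) → sumℕ g ≤ sumℕ f → f ≗ g
sumℕ-≤-tight {suc n} {f} {g} f≤g Σg≤Σf Fin.zero = ≤-antisym (f≤g Fin.zero)
  (+-cancelʳ-≤ (sumℕ (g ∘ Fin.suc)) _ _
    (≤-trans Σg≤Σf (+-monoʳ-≤ (f Fin.zero) (sumℕ-mono (f≤g ∘ Fin.suc)))))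
sumℕ-≤-tight {suc n} {f} {g} f≤g Σg≤Σf (Fin.suc i) = sumℕ-≤-tight (f≤g ∘ Fin.suc)
  (+-cancelˡ-≤ (g Fin.zero) _ _
    (≤-trans Σg≤Σf (+-monoˡ-≤ (sumℕ (f ∘ Fin.suc)) (f≤g Fin.zero)))) i

-- Greedy filling: each entry in turn is raised to `hi` as long as the lower bounds of the later
-- entries still fit into `k`; the first entry where this fails absorbs the remainder, and all later
-- ones stay at `lo`.
shrink : ∀ {n} (lo hi : Fin n → ℕ) k → (∀ i → lo i ≤ hi i) → sumℕ lo ≤ k → k ≤ sumℕ hi →
  Σ (Fin n → ℕ) λ f → (∀ i → lo i ≤ f i) × (∀ i → f i ≤ hi i) × sumℕ f ≡ k
shrink {zero} lo hi k lo≤hi lo≤k k≤hi = lo , (λ ()) , (λ ()) , ≤-antisym lo≤k k≤hi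
shrink {suc n} lo hi k lo≤hi lo≤k k≤hi
  with hi Fin.zero + sumℕ (lo ∘ Fin.suc) ≤? k
... | yes h≤k with shrink (lo ∘ Fin.suc) (hi ∘ Fin.suc) (k ∸ hi Fin.zero) (lo≤hi ∘ Fin.suc)
                     (m+n≤o⇒m≤o∸n _ (subst (_≤ k) (+-comm (hi Fin.zero) _) h≤k))
                     (m≤n+o⇒m∸n≤o k (hi Fin.zero) k≤hi)
...   | f , lo≤f , f≤hi , Σf = (λ { Fin.zero → hi Fin.zero ; (Fin.suc i) → f i })
      , (λ { Fin.zero → lo≤hi Fin.zero ; (Fin.suc i) → lo≤f i })
      , (λ { Fin.zero → ≤-refl ; (Fin.suc i) → f≤hi i })
      , trans (cong (hi Fin.zero ℕ.+_) Σf) (m+[n∸m]≡n (m+n≤o⇒m≤o (hi Fin.zero) h≤k))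
shrink {suc n} lo hi k lo≤hi lo≤k k≤hi | no h≰k =
  (λ { Fin.zero → k ∸ sumℕ (lo ∘ Fin.suc) ; (Fin.suc i) → lo (Fin.suc i) })
  , (λ { Fin.zero → m+n≤o⇒m≤o∸n (lo Fin.zero) lo≤k ; (Fin.suc i) → ≤-refl })
  , (λ { Fin.zero → m≤n+o⇒m∸n≤o k (sumℕ (lo ∘ Fin.suc))
                      (subst (k ≤_) (+-comm (hi Fin.zero) _) (<⇒≤ (≰⇒> h≰k)))
       ; (Fin.suc i) → lo≤hi (Fin.suc i) })
  , m∸n+n≡m (m+n≤o⇒n≤o (lo Fin.zero) lo≤k)

δ : ∀ {n} → Fin n → Fin n → ℕ
δ i j with i Fin.≟ j
... | yes _ = 1
... | no _ = 0

δ-diag : ∀ {n} (i : Fin n) → δ i i ≡ 1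
δ-diag i with i Fin.≟ i
... | yes _ = refl
... | no i≢i = contradiction refl i≢i

δ-suc : ∀ {n} (i j : Fin n) → δ (Fin.suc i) (Fin.suc j) ≡ δ i j
δ-suc i j with i Fin.≟ j
... | yes _ = refl
... | no _ = refl

sumℕ-δ : ∀ {n} (i : Fin n) → sumℕ (δ i) ≡ 1
sumℕ-δ {suc n} Fin.zero = cong suc (sumℕ-zero n)
sumℕ-δ (Fin.suc i) = trans (sumℕ-cong (δ-suc i)) (sumℕ-δ i)

sumℤ-cong : ∀ {n} {f g : Fin n → ℤ} → f ≗ g → sumℤ f ≡ sumℤ g
sumℤ-cong {zero} f≗g = refl
sumℤ-cong {suc n} f≗g = cong₂ ℤ._+_ (f≗g Fin.zero) (sumℤ-cong (f≗g ∘ Fin.suc))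

sumℤ-+ : ∀ {n} (f g : Fin n → ℤ) → sumℤ (λ i → f i ℤ.+ g i) ≡ sumℤ f ℤ.+ sumℤ g
sumℤ-+ {zero} f g = refl
sumℤ-+ {suc n} f g =
  trans (cong (λ z → (f Fin.zero ℤ.+ g Fin.zero) ℤ.+ z) (sumℤ-+ (f ∘ Fin.suc) (g ∘ Fin.suc)))
        (interchange (f Fin.zero) (g Fin.zero) _ _)
  where open CommutativeSemigroupProperties ℤP.+-commutativeSemigroup using (interchange)

sumℤ-neg : ∀ {n} (f : Fin n → ℤ) → sumℤ (λ i → ℤ.- f i) ≡ ℤ.- sumℤ f
sumℤ-neg {zero} f = refl
sumℤ-neg {suc n} f = trans (cong (λ z → ℤ.- f Fin.zero ℤ.+ z) (sumℤ-neg (f ∘ Fin.suc)))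
                           (sym (ℤP.neg-distrib-+ (f Fin.zero) _))

sumℤ-minus : ∀ {n} (f g : Fin n → ℤ) → sumℤ (λ i → f i ℤ.- g i) ≡ sumℤ f ℤ.- sumℤ g
sumℤ-minus f g = trans (sumℤ-+ f (λ i → ℤ.- g i)) (cong (λ z → sumℤ f ℤ.+ z) (sumℤ-neg g))

sumℤ-zero : ∀ n → sumℤ {n} (λ _ → + 0) ≡ + 0
sumℤ-zero zero = refl
sumℤ-zero (suc n) = trans (ℤP.+-identityˡ _) (sumℤ-zero n)

ker-cong : ∀ {m s} (A : Matrix m s) {a b : Fin s → ℤ} → a ≗ b → InKer A a → InKer A b
ker-cong A a≗b a∈ker r = trans (sumℤ-cong (λ j → cong (A r j ℤ.*_) (sym (a≗b j)))) (a∈ker r)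

ker-minus : ∀ {m s} (A : Matrix m s) {a b : Fin s → ℤ} → InKer A a → InKer A b →
  InKer A (λ i → a i ℤ.- b i)
ker-minus A {a} {b} a∈ker b∈ker r =
  trans (sumℤ-cong (λ j → distrib (A r j) (a j) (b j)))
    (trans (sumℤ-minus (λ j → A r j ℤ.* a j) (λ j → A r j ℤ.* b j))
           (cong₂ ℤ._-_ (a∈ker r) (b∈ker r)))
  where
  distrib : ∀ x y z → x ℤ.* (y ℤ.- z) ≡ x ℤ.* y ℤ.- x ℤ.* z
  distrib = ℤSolver.solve-∀

-- Sign-compatible integers.

infix 4 _⊑_

-- Only signs are recorded; sizes are bounded separately. Zero lies below everything, whereas
-- `SameSignBelow` relates zero to zero alone, so this is the relation that survives cancellation in
-- w - a.
data _⊑_ : ℤ → ℤ → Set where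
  zer : ∀ {x} → + 0 ⊑ x
  pos : ∀ {m n} → +[1+ m ] ⊑ +[1+ n ]
  neg : ∀ {m n} → -[1+ m ] ⊑ -[1+ n ]

⊑-refl : ∀ x → x ⊑ x
⊑-refl (+ zero) = zer
⊑-refl +[1+ _ ] = pos
⊑-refl -[1+ _ ] = neg

⊑-trans : ∀ {x y z} → x ⊑ y → y ⊑ z → x ⊑ z
⊑-trans zer _ = zer
⊑-trans pos pos = pos
⊑-trans neg neg = neg

⊑-≢0 : ∀ {x y} → x ⊑ y → x ≢ + 0 → y ≢ + 0
⊑-≢0 zer x≢0 = ⊥-elim (x≢0 refl)
⊑-≢0 pos _ ()
⊑-≢0 neg _ ()

SameSignBelow : ℤ → ℤ → Set
SameSignBelow x w = (sgn x ≡ sgn w) × (∣ x ∣ ≤ ∣ w ∣)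

sameSign⇒⊑ : ∀ x w → SameSignBelow x w → x ⊑ w
sameSign⇒⊑ (+ zero) w _ = zer
sameSign⇒⊑ +[1+ _ ] +[1+ _ ] _ = pos
sameSign⇒⊑ -[1+ _ ] -[1+ _ ] _ = neg
sameSign⇒⊑ -[1+ _ ] (+ zero) (() , _)
sameSign⇒⊑ -[1+ _ ] +[1+ _ ] (() , _)

⊖-⊑ : ∀ m n → n ≤ m → (+ m ℤ.- + n) ⊑ + m × n + ∣ + m ℤ.- + n ∣ ≡ m
⊖-⊑ m n n≤m rewrite ℤP.m-n≡m⊖n m n | ℤP.⊖-≥ n≤m = below (m ∸ n) (m∸n≤m m n) , m+[n∸m]≡n n≤m
  where
  below : ∀ k → k ≤ m → (+ k) ⊑ (+ m)
  below zero _ = zer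
  below (suc k) (s≤s _) = pos

⊑-neg : ∀ {x y} → x ⊑ y → (ℤ.- x) ⊑ (ℤ.- y)
⊑-neg zer = zer
⊑-neg pos = neg
⊑-neg neg = pos

sameSign-minus : ∀ x w → SameSignBelow x w → (w ℤ.- x) ⊑ w × ∣ x ∣ + ∣ w ℤ.- x ∣ ≡ ∣ w ∣
sameSign-minus (+ m) (+ n) (_ , m≤n) = ⊖-⊑ n m m≤n
sameSign-minus +[1+ m ] -[1+ n ] (() , _)
sameSign-minus (+ zero) -[1+ n ] (() , _)
sameSign-minus -[1+ m ] (+ zero) (() , _)
sameSign-minus -[1+ m ] +[1+ n ] (() , _)
-- Two negative numbers are handled by negating the result for their absolute values.
sameSign-minus -[1+ m ] -[1+ n ] (_ , m≤n) with ⊖-⊑ (suc n) (suc m) m≤n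
... | conf , size =
  subst (_⊑ -[1+ n ]) eq (⊑-neg conf) ,
  trans (cong (λ z → suc m + ∣ z ∣) (sym eq))
        (trans (cong (suc m ℕ.+_) (ℤP.∣-i∣≡∣i∣ (+ suc n ℤ.- + suc m))) size)
  where
  flip : ∀ x y → ℤ.- (x ℤ.- y) ≡ ℤ.- x ℤ.- (ℤ.- y)
  flip = ℤSolver.solve-∀
  eq : ℤ.- (+ suc n ℤ.- + suc m) ≡ -[1+ n ] ℤ.- -[1+ m ]
  eq = flip (+ suc n) (+ suc m)

sameSign-∣∣-injective : ∀ x w → sgn x ≡ sgn w → ∣ x ∣ ≡ ∣ w ∣ → x ≡ w
sameSign-∣∣-injective (+ m) (+ n) _ eq = cong (λ k → + k) eq
sameSign-∣∣-injective -[1+ m ] -[1+ n ] _ refl = refl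
sameSign-∣∣-injective (+ zero) -[1+ n ] () _
sameSign-∣∣-injective +[1+ m ] -[1+ n ] () _
sameSign-∣∣-injective -[1+ m ] (+ zero) () _
sameSign-∣∣-injective -[1+ m ] +[1+ n ] () _

sgn-zero : ∀ x → sgn x ≡ + 0 → x ≡ + 0
sgn-zero (+ zero) _ = refl

-- Finite search for a smaller dependency.

extend : ∀ {n} {X : Set} → X → (Fin n → X) → Fin (suc n) → X
extend x f Fin.zero = x
extend x f (Fin.suc i) = f i

-- The search rebuilds a function from its values, so the function found agrees with a given one
-- only pointwise; this is why `P` has to respect `≗`.
choice? : ∀ {n} {X : Set} (L : Fin n → List X) {P : (Fin n → X) → Set} →
  (∀ {f g} → f ≗ g → P f → P g) → (∀ f → Dec (P f)) →
  Dec (Σ (Fin n → X) λ f → (∀ i → f i ∈ L i) × P f)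
choice? {zero} L resp P? with P? (λ ())
... | yes p = yes ((λ ()) , (λ ()) , p)
... | no ¬p = no λ { (f , _ , p) → ¬p (resp (λ ()) p) }
choice? {suc n} L {P} resp P? with any? branch? (L Fin.zero)
  where
  branch? : ∀ x → Dec (Σ (Fin n → _) λ f → (∀ i → f i ∈ L (Fin.suc i)) × P (extend x f))
  branch? x = choice? (L ∘ Fin.suc)
    (λ f≗g → resp (λ { Fin.zero → refl ; (Fin.suc i) → f≗g i })) (P? ∘ extend x)
... | yes found with find found
...   | x , x∈ , f , f∈ , p = yes (extend x f , (λ { Fin.zero → x∈ ; (Fin.suc i) → f∈ i }) , p)
choice? {suc n} L resp P? | no none = no λ { (f , f∈ , p) → none
  (lose (f∈ Fin.zero) (f ∘ Fin.suc , f∈ ∘ Fin.suc ,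
    resp (λ { Fin.zero → refl ; (Fin.suc i) → refl }) p)) }

box : ℤ → List ℤ
box (+ n) = List.map +_ (List.upTo (suc n))
box -[1+ n ] = List.map -[1+_] (List.upTo (suc n))

sameSign∈box : ∀ x w → SameSignBelow x w → x ∈ box w
sameSign∈box (+ m) (+ n) (_ , m≤n) = ∈-map⁺ +_ (∈-upTo⁺ (s≤s m≤n))
sameSign∈box -[1+ m ] -[1+ n ] (_ , s≤s m≤n) = ∈-map⁺ -[1+_] (∈-upTo⁺ (s≤s m≤n))
sameSign∈box (+ zero) -[1+ n ] (() , _)
sameSign∈box +[1+ m ] -[1+ n ] (() , _)
sameSign∈box -[1+ m ] (+ zero) (() , _)
sameSign∈box -[1+ m ] +[1+ n ] (() , _)

Proper : ∀ {m s} → Matrix m s → (Fin s → ℤ) → (Fin s → ℤ) → Set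
Proper A w a = InKer A a × (∀ i → SameSignBelow (a i) (w i)) × ¬ (∀ i → a i ≡ w i)

-- All candidates take their values in the finite lists `box (w i)`. The negative answer is what
-- certifies minimality of a nonzero kernel vector.
proper? : ∀ {m s} (A : Matrix m s) (w : Fin s → ℤ) → Dec (Σ (Fin s → ℤ) (Proper A w))
proper? A w with choice? (box ∘ w) {Proper A w} resp decide
  where
  resp : ∀ {f g} → f ≗ g → Proper A w f → Proper A w g
  resp f≗g (ker , below , f≢w) =
    ker-cong A f≗g ker ,
    (λ i → subst (λ x → SameSignBelow x (w i)) (f≗g i) (below i)) ,
    (λ g≗w → f≢w (λ i → trans (f≗g i) (g≗w i)))
  decide : ∀ f → Dec (Proper A w f)
  decide f = FinP.all? (λ r → _ ℤP.≟ _)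
    ×-dec FinP.all? (λ i → (_ ℤP.≟ _) ×-dec (_ ≤? _))
    ×-dec ¬? (FinP.all? (λ i → _ ℤP.≟ _))
... | yes (a , _ , proper) = yes (a , proper)
... | no none = no λ { (a , proper) →
        none (a , (λ i → sameSign∈box (a i) (w i) (proj₁ (proj₂ proper) i)) , proper) }

-- Passing from a kernel vector to a minimal dependency.

-- `C` stores facts about an index relative to the vector the decomposition starts from. It stays
-- fixed while `w` and `μ` are replaced by pieces.
Good : ∀ {s} → (Fin s → Set) → (Fin s → ℤ) → (Fin s → ℕ) → Set
Good C w μ = (sizeM w < 2 * sumℕ μ) ⊎
  ((sizeM w ≡ 2 * sumℕ μ) × ∃ λ i → C i × (μ i < ∣ w i ∣))

good-nonzero : ∀ {s C} {w : Fin s → ℤ} {μ} → Good C w μ → SubMS w μ → ¬ (∀ i → w i ≡ + 0)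
good-nonzero {s} {w = w} {μ} (inj₁ size<) μ≤w w≡0 = n≮0 (<-≤-trans size< 2Σμ≤0)
  where
  2Σμ≤0 : 2 * sumℕ μ ≤ 0
  2Σμ≤0 = *-monoʳ-≤ 2 (≤-trans (sumℕ-mono (λ i → ≤-trans (μ≤w i) (≤-reflexive (cong ∣_∣ (w≡0 i)))))
                               (≤-reflexive (sumℕ-zero s)))
good-nonzero {w = w} (inj₂ (_ , i , _ , μi<)) _ w≡0 = n≮0 (subst (_ <_) (cong ∣_∣ (w≡0 i)) μi<)

+-<-split : ∀ {a b c d} → a + b < c + d → (a < c) ⊎ (b < d)
+-<-split {a} {b} {c} {d} lt with a <? c
... | yes a<c = inj₁ a<c
... | no a≮c = inj₂ (+-cancelˡ-< c b d (≤-<-trans (+-monoˡ-≤ b (≮⇒≥ a≮c)) lt))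

-- If the sizes of `w` and 2`μ` balance, either one piece has a strict surplus or both balance. In
-- the latter case the strict inequality at `i` is a sum of two and must hold for a piece at the
-- same `i`.
good-split : ∀ {s C} {w a b : Fin s → ℤ} {μ α β} →
  (∀ i → ∣ a i ∣ + ∣ b i ∣ ≡ ∣ w i ∣) → (∀ i → α i + β i ≡ μ i) →
  Good C w μ → Good C a α ⊎ Good C b β
good-split {w = w} {a} {b} {μ} {α} {β} size mult good = go good
  where
  Σw : sizeM a + sizeM b ≡ sizeM w
  Σw = trans (sym (sumℕ-+ (λ i → ∣ a i ∣) (λ i → ∣ b i ∣))) (sumℕ-cong size)
  2Σμ : 2 * sumℕ α + 2 * sumℕ β ≡ 2 * sumℕ μ
  2Σμ = trans (sym (*-distribˡ-+ 2 (sumℕ α) (sumℕ β)))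
              (cong (2 *_) (trans (sym (sumℕ-+ α β)) (sumℕ-cong mult)))
  go : Good _ w μ → Good _ a α ⊎ Good _ b β
  go (inj₁ lt) with +-<-split (subst₂ _<_ (sym Σw) (sym 2Σμ) lt)
  ... | inj₁ a< = inj₁ (inj₁ a<)
  ... | inj₂ b< = inj₂ (inj₁ b<)
  go (inj₂ (eq , i , c , μi<)) with <-cmp (sizeM a) (2 * sumℕ α)
  ... | tri< a< _ _ = inj₁ (inj₁ a<)
  ... | tri> _ _ a> = inj₂ (inj₁ (+-cancelˡ-< (2 * sumℕ α) _ _
          (<-≤-trans (+-monoˡ-< (sizeM b) a>) (≤-reflexive (trans Σw (trans eq (sym 2Σμ)))))))
  ... | tri≈ _ a≡ _ with +-<-split (subst₂ _<_ (sym (mult i)) (sym (size i)) μi<)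
  ...   | inj₁ αi< = inj₁ (inj₂ (a≡ , i , c , αi<))
  ...   | inj₂ βi< = inj₂ (inj₂ (b≡ , i , c , βi<))
    where
    b≡ : sizeM b ≡ 2 * sumℕ β
    b≡ = +-cancelˡ-≡ (2 * sumℕ α) _ _
           (trans (cong (ℕ._+ sizeM b) (sym a≡)) (trans Σw (trans eq (sym 2Σμ))))

nonzero-size : ∀ {s} (a : Fin s → ℤ) → ¬ (∀ i → a i ≡ + 0) → 0 < sizeM a
nonzero-size a a≢0 = n≢0⇒n>0 λ size≡0 → a≢0 λ i →
  ℤP.∣i∣≡0⇒i≡0 (n≤0⇒n≡0 (subst (_ ≤_) size≡0 (term≤sumℕ (λ j → ∣ a j ∣) i)))

-- MinLinDep compares a only with vectors of the very same sign pattern; the supports of the two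
-- pieces a and w − a may shrink.
smaller-good : ∀ {m s C} (A : Matrix m s) {w a : Fin s → ℤ} {μ} →
  InKer A w → Proper A w a → SubMS w μ → Good C w μ →
  Σ (Fin s → ℤ) λ b → Σ (Fin s → ℕ) λ β → (sizeM b < sizeM w) ×
    InKer A b × (∀ i → b i ⊑ w i) × SubMS b β × (∀ i → β i ≤ μ i) × Good C b β
smaller-good {s = s} {C} A {w} {a} {μ} w∈ker (a∈ker , below , a≢w) μ≤w good
  = choose (good-split {C = C} {w} {a} {b} {μ} {α} {β} sizes (λ i → m⊓n+n∸m≡n ∣ a i ∣ (μ i)) good)
  where
  b : Fin s → ℤ
  b i = w i ℤ.- a i
  -- `a` takes as much of `μ` as it can hold and `b` the rest; the rest fits because the absolute
  -- values of `a` and `b` add up to that of `w`.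
  α β : Fin s → ℕ
  α i = ∣ a i ∣ ⊓ μ i
  β i = μ i ∸ ∣ a i ∣
  sizes : ∀ i → ∣ a i ∣ + ∣ b i ∣ ≡ ∣ w i ∣
  sizes i = proj₂ (sameSign-minus (a i) (w i) (below i))
  Σsizes : sizeM a + sizeM b ≡ sizeM w
  Σsizes = trans (sym (sumℕ-+ (λ i → ∣ a i ∣) (λ i → ∣ b i ∣))) (sumℕ-cong sizes)
  a≢0 : ¬ (∀ i → a i ≡ + 0)
  a≢0 a≡0 = good-nonzero {C = C} {w} {μ} good μ≤w λ i →
    sgn-zero (w i) (trans (sym (proj₁ (below i))) (cong sgn (a≡0 i)))
  b≢0 : ¬ (∀ i → b i ≡ + 0)
  b≢0 b≡0 = a≢w λ i → sym (ℤP.i-j≡0⇒i≡j (w i) (a i) (b≡0 i))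
  choose : Good C a α ⊎ Good C b β → _
  choose (inj₁ good-a) = a , α
    , subst (sizeM a <_) Σsizes (m<m+n (sizeM a) (nonzero-size b b≢0))
    , a∈ker , (λ i → sameSign⇒⊑ (a i) (w i) (below i))
    , (λ i → m⊓n≤m ∣ a i ∣ (μ i)) , (λ i → m⊓n≤n ∣ a i ∣ (μ i)) , good-a
  choose (inj₂ good-b) = b , β
    , subst (sizeM b <_) Σsizes (m<n+m (sizeM b) (nonzero-size a a≢0))
    , ker-minus A w∈ker a∈ker , (λ i → proj₁ (sameSign-minus (a i) (w i) (below i)))
    , (λ i → m≤n+o⇒m∸n≤o (μ i) ∣ a i ∣ (subst (μ i ≤_) (sym (sizes i)) (μ≤w i)))
    , (λ i → m∸n≤m (μ i) ∣ a i ∣) , good-b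

minimal-good : ∀ {m s C} (A : Matrix m s) n (w : Fin s → ℤ) μ → sizeM w < n →
  InKer A w → SubMS w μ → Good C w μ →
  Σ (Fin s → ℤ) λ a → Σ (Fin s → ℕ) λ ν →
    MinLinDep A a × (∀ i → a i ⊑ w i) × SubMS a ν × (∀ i → ν i ≤ μ i) × Good C a ν
minimal-good {C = C} A (suc n) w μ (s≤s size≤) w∈ker μ≤w good with proper? A w
... | no none = w , μ , (w∈ker , good-nonzero {C = C} {w} {μ} good μ≤w , minimal)
    , (λ i → ⊑-refl (w i)) , μ≤w , (λ i → ≤-refl) , good
  where
  minimal : ∀ a → InKer A a → (∀ i → SameSignBelow (a i) (w i)) → ∀ i → a i ≡ w i
  minimal a a∈ker below with FinP.all? (λ i → a i ℤP.≟ w i)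
  ... | yes a≡w = a≡w
  ... | no a≢w = contradiction (a , a∈ker , below , a≢w) none
... | yes (a , proper) with smaller-good {C = C} A {w} {a} {μ} w∈ker proper μ≤w good
...   | b , β , size< , b∈ker , b⊑w , β≤b , β≤μ , good-b
  with minimal-good {C = C} A n b β (<-≤-trans size< size≤) b∈ker β≤b good-b
...     | c , ν , min , c⊑b , ν≤c , ν≤β , good-c =
  c , ν , min , (λ i → ⊑-trans (c⊑b i) (b⊑w i)) , ν≤c , (λ i → ≤-trans (ν≤β i) (β≤μ i)) , good-c

leastSupport : ∀ {s} (a : Fin s → ℤ) → ¬ (∀ i → a i ≡ + 0) → Σ (Fin s) (IsMinIndex a)
leastSupport {zero} a a≢0 = contradiction (λ ()) a≢0
leastSupport {suc s} a a≢0 with a Fin.zero ℤP.≟ + 0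
... | no a₀≢0 = Fin.zero , a₀≢0 , (λ j _ → z≤n)
... | yes a₀≡0 with leastSupport (a ∘ Fin.suc)
                      (λ tail≡0 → a≢0 λ { Fin.zero → a₀≡0 ; (Fin.suc i) → tail≡0 i })
...   | i , aᵢ≢0 , least = Fin.suc i , aᵢ≢0 ,
        λ { Fin.zero a₀≢0 → contradiction a₀≡0 a₀≢0 ; (Fin.suc j) aⱼ≢0 → s≤s (least j aⱼ≢0) }

-- Exponent lists and the degree reverse lexicographic order.

degree : ∀ {s} → Mon s → ℕ
degree e = sumL (expList e)

interleave : ∀ {n} → (Fin n → ℕ) → (Fin n → ℕ) → List ℕ
interleave {zero} p q = []
interleave {suc n} p q = p Fin.zero ∷ q Fin.zero ∷ interleave (p ∘ Fin.suc) (q ∘ Fin.suc)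

-- Stated for an arbitrary tabulated `f`, since the tail of `allFin` is the tabulation of `Fin.suc`.
map-vars : ∀ {n s} (e : Mon s) (f : Fin n → Fin s) →
  List.map e (List.concatMap (λ i → pv i ∷ mv i ∷ []) (List.tabulate f)) ≡
  interleave (e ∘ pv ∘ f) (e ∘ mv ∘ f)
map-vars {zero} e f = refl
map-vars {suc n} e f = cong (λ l → e (pv (f Fin.zero)) ∷ e (mv (f Fin.zero)) ∷ l)
                               (map-vars e (f ∘ Fin.suc))

expList-interleave : ∀ {s} (e : Mon s) → expList e ≡ e zv ∷ interleave (e ∘ pv) (e ∘ mv)
expList-interleave e = cong (e zv ∷_) (map-vars e id)

sum-interleave : ∀ {n} (p q : Fin n → ℕ) → sumL (interleave p q) ≡ sumℕ (λ i → p i + q i)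
sum-interleave {zero} p q = refl
sum-interleave {suc n} p q =
  trans (sym (+-assoc (p Fin.zero) _ _))
        (cong ((p Fin.zero + q Fin.zero) ℕ.+_) (sum-interleave (p ∘ Fin.suc) (q ∘ Fin.suc)))

degree-split : ∀ {s} (e : Mon s) → degree e ≡ e zv + sumℕ (λ i → e (pv i) + e (mv i))
degree-split e = trans (cong sumL (expList-interleave e))
                       (cong (e zv ℕ.+_) (sum-interleave (e ∘ pv) (e ∘ mv)))

interleave-injective : ∀ {n} {p q p′ q′ : Fin n → ℕ} → interleave p q ≡ interleave p′ q′ →
  p ≗ p′ × q ≗ q′
interleave-injective {zero} eq = (λ ()) , (λ ())
interleave-injective {suc n} eq with ListP.∷-injective eq
... | p₀ , eq₁ with ListP.∷-injective eq₁
...   | q₀ , eq₂ with interleave-injective eq₂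
...     | ps , qs = (λ { Fin.zero → p₀ ; (Fin.suc i) → ps i }) ,
                (λ { Fin.zero → q₀ ; (Fin.suc i) → qs i })

expList-cong : ∀ {s} {e e′ : Mon s} → e ≗ e′ → expList e ≡ expList e′
expList-cong {s} e≗e′ = ListP.map-cong e≗e′ (vars s)

expList-injective : ∀ {s} {e e′ : Mon s} → expList e ≡ expList e′ → e ≗ e′
expList-injective {e = e} {e′} eq = pointwise
  where
  split = ListP.∷-injective (trans (sym (expList-interleave e)) (trans eq (expList-interleave e′)))
  pointwise : e ≗ e′
  pointwise zv = proj₁ split
  pointwise (pv i) = proj₁ (interleave-injective (proj₂ split)) i
  pointwise (mv i) = proj₂ (interleave-injective (proj₂ split)) i

-- The tie-break read pair by pair, x₊ before x₋: at the first variable where the exponents differ,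
-- the smaller monomial has the larger exponent.
FirstDiff : ∀ {n} (p q p′ q′ : Fin n → ℕ) → Set
FirstDiff p q p′ q′ = ∃ λ i → (∀ j → j Fin.< i → p j ≡ p′ j × q j ≡ q′ j) ×
  ((p′ i < p i) ⊎ ((p i ≡ p′ i) × (q′ i < q i)))

firstDiff⇒≺rev : ∀ {n} {p q p′ q′ : Fin n → ℕ} → FirstDiff p q p′ q′ →
  interleave p q ≺rev interleave p′ q′
firstDiff⇒≺rev (Fin.zero , _ , inj₁ lt) = inj₁ lt
firstDiff⇒≺rev (Fin.zero , _ , inj₂ (eq , lt)) = inj₂ (eq , inj₁ lt)
firstDiff⇒≺rev (Fin.suc i , before , diff) = inj₂ (proj₁ (before Fin.zero (s≤s z≤n)) ,
  inj₂ (proj₂ (before Fin.zero (s≤s z≤n)) ,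
    firstDiff⇒≺rev (i , (λ j j<i → before (Fin.suc j) (s≤s j<i)) , diff)))

≺rev⇒firstDiff : ∀ {n} {p q p′ q′ : Fin n → ℕ} → interleave p q ≺rev interleave p′ q′ →
  FirstDiff p q p′ q′
≺rev⇒firstDiff {zero} ()
≺rev⇒firstDiff {suc n} (inj₁ lt) = Fin.zero , (λ _ ()) , inj₁ lt
≺rev⇒firstDiff {suc n} (inj₂ (eq , inj₁ lt)) = Fin.zero , (λ _ ()) , inj₂ (eq , lt)
≺rev⇒firstDiff {suc n} (inj₂ (eq , inj₂ (eq′ , rest))) with ≺rev⇒firstDiff rest
... | i , before , diff = Fin.suc i ,
      (λ { Fin.zero _ → eq , eq′ ; (Fin.suc j) (s≤s j<i) → before j j<i }) , diff

≺rev-cmp : ∀ as bs → List.length as ≡ List.length bs →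
  (as ≺rev bs) ⊎ (as ≡ bs) ⊎ (bs ≺rev as)
≺rev-cmp [] [] _ = inj₂ (inj₁ refl)
≺rev-cmp (a ∷ as) (b ∷ bs) len with <-cmp a b
... | tri< a<b _ _ = inj₂ (inj₂ (inj₁ a<b))
... | tri> _ _ b<a = inj₁ (inj₁ b<a)
... | tri≈ _ refl _ with ≺rev-cmp as bs (suc-injective len)
...   | inj₁ lt = inj₁ (inj₂ (refl , lt))
...   | inj₂ (inj₁ refl) = inj₂ (inj₁ refl)
...   | inj₂ (inj₂ gt) = inj₂ (inj₂ (inj₂ (refl , gt)))

≺rev? : ∀ as bs → Dec (as ≺rev bs)
≺rev? [] bs = no λ ()
≺rev? (a ∷ as) [] = no λ ()
≺rev? (a ∷ as) (b ∷ bs) = (b <? a) ⊎-dec ((a ≟ b) ×-dec ≺rev? as bs)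

≺? : ∀ {s} (e e′ : Mon s) → Dec (e ≺ e′)
≺? e e′ = (_ <? _) ⊎-dec ((_ ≟ _) ×-dec ≺rev? _ _)

≺-cmp : ∀ {s} (e e′ : Mon s) → degree e ≡ degree e′ →
  (e ≺ e′) ⊎ (expList e ≡ expList e′) ⊎ (e′ ≺ e)
≺-cmp {s} e e′ deg with ≺rev-cmp (expList e) (expList e′)
  (trans (ListP.length-map e (vars s)) (sym (ListP.length-map e′ (vars s))))
... | inj₁ lt = inj₁ (inj₂ (deg , lt))
... | inj₂ (inj₁ eq) = inj₂ (inj₁ eq)
... | inj₂ (inj₂ gt) = inj₂ (inj₂ (inj₂ (sym deg , gt)))

≺rev-irrefl : ∀ as → ¬ (as ≺rev as)
≺rev-irrefl (a ∷ as) (inj₁ a<a) = n≮n a a<a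
≺rev-irrefl (a ∷ as) (inj₂ (_ , lt)) = ≺rev-irrefl as lt

≺⇒≢ : ∀ {s} {e e′ : Mon s} → e ≺ e′ → expList e ≢ expList e′
≺⇒≢ (inj₁ lt) eq = <⇒≢ lt (cong sumL eq)
≺⇒≢ {e = e} (inj₂ (_ , lt)) eq = ≺rev-irrefl (expList e) (subst (expList e ≺rev_) (sym eq) lt)

sum-map-+ : ∀ {X : Set} (f g : X → ℕ) xs →
  sumL (List.map (λ x → f x + g x) xs) ≡ sumL (List.map f xs) + sumL (List.map g xs)
sum-map-+ f g [] = refl
sum-map-+ f g (x ∷ xs) = trans (cong ((f x + g x) ℕ.+_) (sum-map-+ f g xs)) (+-interchange (f x) _ _ _)

degree-mul : ∀ {s} (e e′ : Mon s) → degree (mulMon e e′) ≡ degree e + degree e′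
degree-mul {s} e e′ = sum-map-+ e e′ (vars s)

≺rev-mul : ∀ {X : Set} (r v u : X → ℕ) xs → List.map v xs ≺rev List.map u xs →
  List.map (λ x → r x + v x) xs ≺rev List.map (λ x → r x + u x) xs
≺rev-mul r v u (x ∷ xs) (inj₁ lt) = inj₁ (+-monoʳ-< (r x) lt)
≺rev-mul r v u (x ∷ xs) (inj₂ (eq , lt)) = inj₂ (cong (r x ℕ.+_) eq , ≺rev-mul r v u xs lt)

≺-mul : ∀ {s} (r : Mon s) {v u : Mon s} → v ≺ u → mulMon r v ≺ mulMon r u
≺-mul r {v} {u} (inj₁ lt) = inj₁
  (subst₂ _<_ (sym (degree-mul r v)) (sym (degree-mul r u)) (+-monoʳ-< (degree r) lt))
≺-mul {s} r {v} {u} (inj₂ (eq , lt)) = inj₂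
  (trans (degree-mul r v) (trans (cong (degree r ℕ.+_) eq) (sym (degree-mul r u))) ,
   ≺rev-mul r v u (vars s) lt)

-- A list of exponents ≤ D is read as the digits D ∸ a in base 1 + D, so ≺rev becomes < on ℕ.
rank : ℕ → List ℕ → ℕ
rank D [] = 0
rank D (a ∷ as) = (D ∸ a) * suc D ^ List.length as + rank D as

rank-bound : ∀ D as → rank D as < suc D ^ List.length as
rank-bound D [] = s≤s z≤n
rank-bound D (a ∷ as) = begin-strict
  (D ∸ a) * B + rank D as <⟨ +-monoʳ-< ((D ∸ a) * B) (rank-bound D as) ⟩
  (D ∸ a) * B + B         ≤⟨ +-monoˡ-≤ B (*-monoˡ-≤ B (m∸n≤m D a)) ⟩
  D * B + B               ≡⟨ +-comm (D * B) B ⟩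
  suc D * B               ∎
  where
  open ≤-Reasoning
  B = suc D ^ List.length as

rank-mono : ∀ D as bs → List.length as ≡ List.length bs → sumL as ≤ D → as ≺rev bs →
  rank D as < rank D bs
rank-mono D (a ∷ as) (b ∷ bs) len Σ≤D (inj₂ (refl , lt)) rewrite suc-injective len =
  +-monoʳ-< ((D ∸ a) * suc D ^ List.length bs)
    (rank-mono D as bs (suc-injective len) (≤-trans (m≤n+m _ a) Σ≤D) lt)
rank-mono D (a ∷ as) (b ∷ bs) len Σ≤D (inj₁ b<a) = begin-strict
  (D ∸ a) * B + rank D as <⟨ +-monoʳ-< ((D ∸ a) * B) (rank-bound D as) ⟩
  (D ∸ a) * B + B         ≡⟨ +-comm _ B ⟩
  suc (D ∸ a) * B         ≤⟨ *-monoˡ-≤ B (∸-monoʳ-< b<a (≤-trans (m≤m+n a _) Σ≤D)) ⟩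
  (D ∸ b) * B             ≡⟨ cong (λ k → (D ∸ b) * suc D ^ k) (suc-injective len) ⟩
  (D ∸ b) * B′            ≤⟨ m≤m+n _ _ ⟩
  (D ∸ b) * B′ + rank D bs ∎
  where
  open ≤-Reasoning
  B = suc D ^ List.length as
  B′ = suc D ^ List.length bs

-- All monomials of a fiber have the same degree, hence the same base, so inside a fiber this is a
-- natural number that drops along `≺`. It serves as the termination measure for rewriting.
height : ∀ {s} → Mon s → ℕ
height e = rank (degree e) (expList e)

height-mono : ∀ {s} {e e′ : Mon s} → degree e ≡ degree e′ → e ≺ e′ → height e < height e′
height-mono deg (inj₁ lt) = contradiction deg (<⇒≢ lt)
height-mono {s} {e} {e′} deg (inj₂ (_ , lt)) =
  subst (λ D → height e < rank D (expList e′)) deg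
    (rank-mono (degree e) (expList e) (expList e′)
      (trans (ListP.length-map e (vars s)) (sym (ListP.length-map e′ (vars s)))) ≤-refl lt)

-- Fibers of the toric map, and the listed binomials inside them.

net : ∀ {s} → Mon s → Fin s → ℤ
net e i = + e (pv i) ℤ.- + e (mv i)

net-cong : ∀ {s} {e e′ : Mon s} → e ≗ e′ → net e ≗ net e′
net-cong e≗e′ i = cong₂ (λ p q → + p ℤ.- + q) (e≗e′ (pv i)) (e≗e′ (mv i))

net-mul : ∀ {s} (r u : Mon s) i → net (mulMon r u) i ≡ net r i ℤ.+ net u i
net-mul r u i = rearrange (+ r (pv i)) (+ u (pv i)) (+ r (mv i)) (+ u (mv i))
  where
  rearrange : ∀ a b c d → (a ℤ.+ b) ℤ.- (c ℤ.+ d) ≡ (a ℤ.- c) ℤ.+ (b ℤ.- d)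
  rearrange = ℤSolver.solve-∀

module Fibers {c ℓ} (K : Field c ℓ) {m s} (A : Matrix m s) where

  img : Mon s → Vec ℤ m × ℕ
  img = toricImg K A

  weight : (Fin s → ℤ) → Fin m → ℤ
  weight x r = sumℤ (λ i → x i ℤ.* A r i)

  img-intro : ∀ u v a → InKer A a → degree u ≡ degree v →
    (∀ i → net u i ≡ net v i ℤ.+ a i) → img u ≡ img v
  img-intro u v a a∈ker deg shift = cong₂ _,_ (VecP.tabulate-cong weights) deg
    where
    distrib : ∀ x y z → (x ℤ.+ y) ℤ.* z ≡ x ℤ.* z ℤ.+ z ℤ.* y
    distrib = ℤSolver.solve-∀
    weights : ∀ r → weight (net u) r ≡ weight (net v) r
    weights r = trans
      (sumℤ-cong (λ i → trans (cong (ℤ._* A r i) (shift i)) (distrib (net v i) (a i) (A r i))))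
      (trans (sumℤ-+ (λ i → net v i ℤ.* A r i) (λ i → A r i ℤ.* a i))
        (trans (cong (λ z → weight (net v) r ℤ.+ z) (a∈ker r)) (ℤP.+-identityʳ _)))

  img-degree : ∀ u v → img u ≡ img v → degree u ≡ degree v
  img-degree u v = cong proj₂

  img-kernel : ∀ {u v} → img u ≡ img v → InKer A (λ i → net u i ℤ.- net v i)
  img-kernel {u} {v} eq r = trans
    (sumℤ-cong (λ i → distrib (A r i) (net u i) (net v i)))
    (trans (sumℤ-minus (λ i → net u i ℤ.* A r i) (λ i → net v i ℤ.* A r i))
           (ℤP.i≡j⇒i-j≡0 weights))
    where
    distrib : ∀ x y z → x ℤ.* (y ℤ.- z) ≡ y ℤ.* x ℤ.- z ℤ.* x
    distrib = ℤSolver.solve-∀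
    weights : weight (net u) r ≡ weight (net v) r
    weights = trans (sym (VecP.lookup∘tabulate (weight (net u)) r))
      (trans (cong (λ w → Vec.lookup (proj₁ w) r) eq) (VecP.lookup∘tabulate (weight (net v)) r))

  img-cong : ∀ {u v} → u ≗ v → img u ≡ img v
  img-cong {u} {v} u≗v = cong₂ _,_
    (VecP.tabulate-cong λ r → sumℤ-cong λ i → cong (ℤ._* A r i) (net-cong u≗v i))
    (cong sumL (expList-cong u≗v))

  img-mul : ∀ r {u v} → img u ≡ img v → img (mulMon r u) ≡ img (mulMon r v)
  img-mul r {u} {v} eq = img-intro (mulMon r u) (mulMon r v)
    (λ i → net u i ℤ.- net v i) (img-kernel eq)
    (trans (degree-mul r u) (trans (cong (degree r ℕ.+_) (img-degree u v eq)) (sym (degree-mul r v))))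
    λ i → trans (net-mul r u i) (trans (rearrange (net r i) (net u i) (net v i))
                 (cong (λ z → z ℤ.+ (net u i ℤ.- net v i)) (sym (net-mul r v i))))
    where
    rearrange : ∀ x y z → x ℤ.+ y ≡ (x ℤ.+ z) ℤ.+ (y ℤ.- z)
    rearrange = ℤSolver.solve-∀

  Reduces : Mon s → Mon s → Set
  Reduces u v = (img u ≡ img v) × (v ≺ u)

  degree-monM : ∀ (a : Fin s → ℤ) μ → SubMS a μ → degree (monM K a μ) ≡ sumℕ μ
  degree-monM a μ μ≤a = trans (degree-split {s} (monM K a μ)) (sumℕ-cong λ i → merge (a i) (μ i) (μ≤a i))
    where
    merge : ∀ x n → n ≤ ∣ x ∣ → ifPos K x n + ifNeg K x n ≡ n
    merge (+ zero) n n≤0 = sym (n≤0⇒n≡0 n≤0)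
    merge +[1+ _ ] n _ = +-identityʳ n
    merge -[1+ _ ] n _ = refl

  degree-monC : ∀ (a : Fin s → ℤ) μ d → SubMS a μ → degree (monC K a μ d) + sumℕ μ ≡ d + sizeM a
  degree-monC a μ d μ≤a =
    trans (cong (ℕ._+ sumℕ μ) (degree-split (monC K a μ d)))
      (trans (+-assoc d _ _) (cong (d ℕ.+_) (trans
        (sym (sumℕ-+ (λ i → monC K a μ d (pv i) + monC K a μ d (mv i)) μ))
        (sumℕ-cong λ i → merge (a i) (μ i) (μ≤a i)))))
    where
    merge : ∀ x n → n ≤ ∣ x ∣ → (ifNeg K x (∣ x ∣ ∸ n) + ifPos K x (∣ x ∣ ∸ n)) + n ≡ ∣ x ∣
    merge (+ zero) n n≤0 = n≤0⇒n≡0 n≤0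
    merge +[1+ _ ] n n≤ = m∸n+n≡m n≤
    merge -[1+ _ ] n n≤ = trans (cong (ℕ._+ n) (+-identityʳ _)) (m∸n+n≡m n≤)

  net-monM : ∀ (a : Fin s → ℤ) μ d → SubMS a μ → ∀ i →
    net (monM K a μ) i ≡ net (monC K a μ d) i ℤ.+ a i
  net-monM a μ d μ≤a i = shift (a i) (μ i) (μ≤a i)
    where
    cancel : ∀ x y → x ≡ (+ 0 ℤ.- y) ℤ.+ (y ℤ.+ x)
    cancel = ℤSolver.solve-∀
    cancel′ : ∀ x y → + 0 ℤ.- x ≡ (y ℤ.- + 0) ℤ.+ (ℤ.- (y ℤ.+ x))
    cancel′ = ℤSolver.solve-∀
    shift : ∀ x n → n ≤ ∣ x ∣ → + ifPos K x n ℤ.- + ifNeg K x n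
      ≡ (+ ifNeg K x (∣ x ∣ ∸ n) ℤ.- + ifPos K x (∣ x ∣ ∸ n)) ℤ.+ x
    shift (+ zero) n _ = refl
    shift +[1+ k ] n n≤ = trans (ℤP.+-identityʳ (+ n)) (trans (cancel (+ n) (+ (suc k ∸ n)))
      (cong (λ z → (+ 0 ℤ.- + (suc k ∸ n)) ℤ.+ + z) (m∸n+n≡m n≤)))
    shift -[1+ k ] n n≤ = trans (cancel′ (+ n) (+ (suc k ∸ n)))
      (cong (λ z → (+ (suc k ∸ n) ℤ.- + 0) ℤ.+ (ℤ.- (+ z))) (m∸n+n≡m n≤))

  -- Moving the complementary share to the other side flips its sign, so the two net exponents
  -- differ by exactly `a`, which A kills. Homogeneity then fixes the power `d` of z; the three
  -- families (1), (2), (3) have `d` = 0, 1, 2.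
  same-image : ∀ (a : Fin s → ℤ) μ d → InKer A a → SubMS a μ → sumℕ μ + sumℕ μ ≡ d + sizeM a →
    img (monM K a μ) ≡ img (monC K a μ d)
  same-image a μ d a∈ker μ≤a 2Σμ = img-intro (monM K a μ) (monC K a μ d) a a∈ker
    (+-cancelʳ-≡ (sumℕ μ) _ _
      (trans (cong (ℕ._+ sumℕ μ) (degree-monM a μ μ≤a)) (trans 2Σμ (sym (degree-monC a μ d μ≤a)))))
    (net-monM a μ d μ≤a)

  z-≺ : ∀ (u v : Mon s) → img u ≡ img v → u zv < v zv → v ≺ u
  z-≺ u v eq lt = inj₂ (sym (img-degree u v eq) , inj₁ lt)

  pair-≺ : ∀ (u v : Mon s) → img u ≡ img v → v zv ≡ u zv →
    FirstDiff (v ∘ pv) (v ∘ mv) (u ∘ pv) (u ∘ mv) → v ≺ u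
  pair-≺ u v eq z diff = inj₂ (sym (img-degree u v eq) ,
    subst₂ _≺rev_ (sym (expList-interleave v)) (sym (expList-interleave u))
      (inj₂ (z , firstDiff⇒≺rev diff)))

  -- The comparison at the minimal index. If `x` > 0, condition (a) removes both variables of the
  -- pair from the first monomial, while the second keeps x₋. If `x` < 0, condition (b) leaves an x₊
  -- in the second monomial, and the first has none.
  min-diff : ∀ x n → x ≢ + 0 → (+ 0 ℤ.< x → n ≡ 0) → (x ℤ.< + 0 → ¬ (∣ x ∣ ≤ n)) →
    (ifPos K x n < ifNeg K x (∣ x ∣ ∸ n)) ⊎
    ((ifNeg K x (∣ x ∣ ∸ n) ≡ ifPos K x n) × (ifNeg K x n < ifPos K x (∣ x ∣ ∸ n)))
  min-diff (+ zero) n x≢0 _ _ = contradiction refl x≢0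
  min-diff +[1+ k ] n _ pos⇒0 _ with pos⇒0 (ℤ.+<+ (s≤s z≤n))
  ... | refl = inj₂ (refl , s≤s z≤n)
  min-diff -[1+ k ] n _ _ neg⇒< = inj₁ (m<n⇒0<n∸m (≰⇒> (neg⇒< ℤ.-<+)))

  off-support : ∀ {a : Fin s → ℤ} {i j} → IsMinIndex a i → j Fin.< i → a j ≡ + 0
  off-support {a} {i} {j} (_ , least) j<i with a j ℤP.≟ + 0
  ... | yes aⱼ≡0 = aⱼ≡0
  ... | no aⱼ≢0 = contradiction (least j aⱼ≢0) (<⇒≱ j<i)

  monPM-pv : ∀ (i j : Fin s) → monPM K i (pv j) ≡ δ i j
  monPM-pv i j with i Fin.≟ j
  ... | yes _ = refl
  ... | no _ = refl

  monPM-mv : ∀ (i j : Fin s) → monPM K i (mv j) ≡ δ i j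
  monPM-mv i j with i Fin.≟ j
  ... | yes _ = refl
  ... | no _ = refl

  gens-reduce : ∀ {p} → Gens K A p →
    Σ (Mon s) λ u → Σ (Mon s) λ v → (p ≡ binom K u v) × Reduces u v
  gens-reduce (inj₁ (a , (a∈ker , _) , i , min , k , size , μ , μ≤a , Σμ , pos⇒0 , neg⇒< , eq)) =
    _ , _ , eq , same , pair-≺ _ _ same refl (i , before ,
      min-diff (a i) (μ i) (proj₁ min) pos⇒0 neg⇒<)
    where
    double : ∀ k → k + k ≡ 2 * k
    double = solve-∀
    same : img (monM K a μ) ≡ img (monC K a μ 0)
    same = same-image a μ 0 a∈ker μ≤a (trans (cong₂ _+_ Σμ Σμ) (trans (double k) (sym size)))
    before : ∀ j → j Fin.< i →
      monC K a μ 0 (pv j) ≡ monM K a μ (pv j) × monC K a μ 0 (mv j) ≡ monM K a μ (mv j)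
    before j j<i rewrite off-support {a} {i} {j} min j<i = refl , refl
  -- In the remaining families z divides the second monomial only, and z is the first variable
  -- compared.
  gens-reduce (inj₂ (inj₁ (a , (a∈ker , _) , k , size , μ , μ≤a , Σμ , eq))) =
    _ , _ , eq , same , z-≺ _ _ same (s≤s z≤n)
    where
    double : ∀ k → (k + 1) + (k + 1) ≡ 1 + (2 * k + 1)
    double = solve-∀
    same : img (monM K a μ) ≡ img (monC K a μ 1)
    same = same-image a μ 1 a∈ker μ≤a (trans (cong₂ _+_ Σμ Σμ) (trans (double k) (cong suc (sym size))))
  gens-reduce (inj₂ (inj₂ (inj₁ (a , (a∈ker , _) , i , min , k , size , μ , μ≤a , Σμ , _ , _ , eq)))) =
    _ , _ , eq , same , z-≺ _ _ same (s≤s z≤n)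
    where
    double : ∀ k → (k + 1) + (k + 1) ≡ 2 + 2 * k
    double = solve-∀
    same : img (monM K a μ) ≡ img (monC K a μ 2)
    same = same-image a μ 2 a∈ker μ≤a (trans (cong₂ _+_ Σμ Σμ) (trans (double k) (cong (2 ℕ.+_) (sym size))))
  gens-reduce (inj₂ (inj₂ (inj₂ (i , eq)))) = _ , _ , eq , same , z-≺ _ _ same (s≤s z≤n)
    where
    same : img (monPM K i) ≡ img (monZ2 K)
    same = img-intro (monPM K i) (monZ2 K) (λ _ → + 0)
      (λ r → trans (sumℤ-cong (λ j → ℤP.*-zeroʳ (A r j))) (sumℤ-zero s))
      (trans (degree-split (monPM K i)) (trans
         (trans (sumℕ-cong (λ j → cong₂ _+_ (monPM-pv i j) (monPM-mv i j)))
           (trans (sumℕ-+ (δ i) (δ i)) (cong₂ _+_ (sumℕ-δ i) (sumℕ-δ i))))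
         (sym (trans (degree-split {s} (monZ2 K)) (cong (2 ℕ.+_) (sumℕ-zero s))))))
      (λ j → trans (cong₂ (λ p q → + p ℤ.- + q) (monPM-pv i j) (monPM-mv i j))
                   (ℤP.+-inverseʳ (+ δ i j)))

-- Estimates at a single index.

-- How many of the |x| copies of the signed column the exponents `p` of x₊ and `q` of x₋ can supply;
-- only the exponent on the side of the sign counts.
part : ℤ → ℕ → ℕ → ℕ
part (+ zero) p q = 0
part +[1+ k ] p q = p ⊓ suc k
part -[1+ k ] p q = q ⊓ suc k

part≤∣∣ : ∀ x p q → part x p q ≤ ∣ x ∣
part≤∣∣ (+ zero) p q = z≤n
part≤∣∣ +[1+ k ] p q = m⊓n≤n p (suc k)
part≤∣∣ -[1+ k ] p q = m⊓n≤n q (suc k)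

Difference : ℤ → (p q p′ q′ : ℕ) → Set
Difference x p q p′ q′ = x ≡ (+ p ℤ.- + q) ℤ.- (+ p′ ℤ.- + q′)

difference-+ : ∀ {k p q p′ q′} → Difference (+ k) p q p′ q′ → p + q′ ≡ (q + p′) + k
difference-+ {k} {p} {q} {p′} {q′} eq = ℤP.+-injective
  (trans (rearrange (+ p) (+ q) (+ p′) (+ q′)) (cong (λ z → (+ q ℤ.+ + p′) ℤ.+ z) (sym eq)))
  where
  rearrange : ∀ a b c d → a ℤ.+ d ≡ (b ℤ.+ c) ℤ.+ ((a ℤ.- b) ℤ.- (c ℤ.- d))
  rearrange = ℤSolver.solve-∀

difference-swap : ∀ {x p q p′ q′} → Difference x p q p′ q′ → Difference (ℤ.- x) q p q′ p′
difference-swap {x} {p} {q} {p′} {q′} eq = trans (cong ℤ.-_ eq) (rearrange (+ p) (+ q) (+ p′) (+ q′))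
  where
  rearrange : ∀ a b c d → ℤ.- ((a ℤ.- b) ℤ.- (c ℤ.- d)) ≡ (b ℤ.- a) ℤ.- (d ℤ.- c)
  rearrange = ℤSolver.solve-∀

difference-- : ∀ {k p q p′ q′} → Difference -[1+ k ] p q p′ q′ → q + p′ ≡ (p + q′) + suc k
difference-- {k} {p} {q} {p′} {q′} eq =
  difference-+ {suc k} {q} {p} {q′} {p′} (difference-swap { -[1+ k ]} {p} {q} {p′} {q′} eq)

-- The slack is twice an exponent of v: 2`p′` if `p` ≤ `k` or `p` = 0, and 2`q′` if `k` ≤ `p` and
-- `q` = 0.
deficit-+ : ∀ p q p′ q′ k → p + q′ ≡ (q + p′) + k → (p ≡ 0) ⊎ (q ≡ 0) →
  k + (p + q) ≤ 2 * (p ⊓ k) + (p′ + q′)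
deficit-+ p q p′ q′ k eq pairless with ≤-total p k
... | inj₁ p≤k rewrite m≤n⇒m⊓n≡m p≤k = begin
  k + (p + q)                    ≤⟨ m≤m+n _ (p′ + p′) ⟩
  k + (p + q) + (p′ + p′)        ≡⟨ e₁ k p q p′ ⟩
  p + p′ + ((q + p′) + k)        ≡⟨ cong ((p + p′) ℕ.+_) (sym eq) ⟩
  p + p′ + (p + q′)              ≡⟨ e₂ p p′ q′ ⟩
  2 * p + (p′ + q′)              ∎
  where
  open ≤-Reasoning
  e₁ : ∀ k p q r → k + (p + q) + (r + r) ≡ p + r + ((q + r) + k)
  e₁ = solve-∀
  e₂ : ∀ p r t → p + r + (p + t) ≡ 2 * p + (r + t)
  e₂ = solve-∀
deficit-+ p q p′ q′ k eq (inj₁ refl) | inj₂ z≤n = begin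
  q                    ≤⟨ m≤m+n q _ ⟩
  q + (p′ + p′)        ≡⟨ e₁ q p′ ⟩
  p′ + ((q + p′) + 0)  ≡⟨ cong (p′ ℕ.+_) (sym eq) ⟩
  p′ + q′              ∎
  where
  open ≤-Reasoning
  e₁ : ∀ q r → q + (r + r) ≡ r + ((q + r) + 0)
  e₁ = solve-∀
deficit-+ p q p′ q′ k eq (inj₂ refl) | inj₂ k≤p rewrite m≥n⇒m⊓n≡n k≤p = begin
  k + (p + 0)            ≤⟨ m≤m+n _ (q′ + q′) ⟩
  k + (p + 0) + (q′ + q′) ≡⟨ e₁ k p q′ ⟩
  k + (p + q′) + q′      ≡⟨ cong (λ z → k + z + q′) eq ⟩
  k + (p′ + k) + q′      ≡⟨ e₂ k p′ q′ ⟩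
  2 * k + (p′ + q′)      ∎
  where
  open ≤-Reasoning
  e₁ : ∀ k p t → k + (p + 0) + (t + t) ≡ k + (p + t) + t
  e₁ = solve-∀
  e₂ : ∀ k r t → k + (r + k) + t ≡ 2 * k + (r + t)
  e₂ = solve-∀

deficit : ∀ x p q p′ q′ → Difference x p q p′ q′ → (p ≡ 0) ⊎ (q ≡ 0) →
  ∣ x ∣ + (p + q) ≤ 2 * part x p q + (p′ + q′)
deficit (+ zero) p q p′ q′ diff pairless =
  subst (λ z → p + q ≤ 2 * z + (p′ + q′)) (⊓-zeroʳ p)
    (deficit-+ p q p′ q′ 0 (difference-+ {0} {p} {q} {p′} {q′} diff) pairless)
deficit +[1+ k ] p q p′ q′ diff pairless =
  deficit-+ p q p′ q′ (suc k) (difference-+ {suc k} {p} {q} {p′} {q′} diff) pairless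
deficit -[1+ k ] p q p′ q′ diff pairless =
  subst₂ (λ y z → suc k + y ≤ 2 * (q ⊓ suc k) + z) (+-comm q p) (+-comm q′ p′)
    (deficit-+ q p q′ p′ (suc k) (difference-- {k} {p} {q} {p′} {q′} diff) (swap pairless))

-- Equality in the deficit bound means that v = (p′ , q′) has no x₊x₋ factor, so the variable in
-- which v first exceeds u = (p , q) decides the sign of x.
tight : ∀ x p q p′ q′ → Difference x p q p′ q′ → ∣ x ∣ + (p + q) ≡ 2 * part x p q + (p′ + q′) →
  (p < p′) ⊎ ((p′ ≡ p) × (q < q′)) → (part x p q < ∣ x ∣) × (+ 0 ℤ.< x → part x p q ≡ 0)
-- Adding the two equations gives 2`p′` + 2`t` = 2`p`, so `p` < `p′` cannot occur for a nonnegative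
-- difference.
tight (+ k) p q p′ q′ diff eq (inj₁ p<p′) = contradiction p<p′ (≤⇒≯ (*-cancelˡ-≤ 2 (begin
  2 * p′            ≤⟨ m≤m+n _ (2 * t) ⟩
  2 * p′ + 2 * t    ≡⟨ +-cancelʳ-≡ (k + q + q′) _ _ (begin-equality
     2 * p′ + 2 * t + (k + q + q′)         ≡⟨ e₁ p′ (2 * t) k q q′ ⟩
     ((q + p′) + k) + (2 * t + (p′ + q′))
       ≡⟨ cong₂ _+_ (sym (difference-+ {k} {p} {q} {p′} {q′} diff)) (sym eq) ⟩
     (p + q′) + (k + (p + q))              ≡⟨ e₂ p q′ k q ⟩
     2 * p + (k + q + q′)                  ∎) ⟩
  2 * p             ∎)))
  where
  open ≤-Reasoning
  t = part (+ k) p q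
  e₁ : ∀ r t k q s → 2 * r + t + (k + q + s) ≡ ((q + r) + k) + (t + (r + s))
  e₁ = solve-∀
  e₂ : ∀ p s k q → (p + s) + (k + (p + q)) ≡ 2 * p + (k + q + s)
  e₂ = solve-∀
-- For a negative difference the same sum reads 2`p′` + 2`t` = 2`p` + 2|x|, and `p` < `p′` forces
-- `t` < |x|.
tight -[1+ k ] p q p′ q′ diff eq (inj₁ p<p′) =
  *-cancelˡ-< 2 t (suc k) (+-cancelˡ-< (2 * p′) _ _ (begin-strict
    2 * p′ + 2 * t       ≡⟨ +-cancelʳ-≡ (q + q′) _ _ (begin-equality
       2 * p′ + 2 * t + (q + q′)              ≡⟨ e₁ p′ (2 * t) q q′ ⟩
       (q + p′) + (2 * t + (p′ + q′))
         ≡⟨ cong₂ _+_ (difference-- {k} {p} {q} {p′} {q′} diff) (sym eq) ⟩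
       ((p + q′) + suc k) + (suc k + (p + q)) ≡⟨ e₂ p q′ (suc k) q ⟩
       2 * p + 2 * suc k + (q + q′)           ∎) ⟩
    2 * p + 2 * suc k    <⟨ +-monoˡ-< (2 * suc k) (*-monoʳ-< 2 p<p′) ⟩
    2 * p′ + 2 * suc k   ∎)) , λ ()
  where
  open ≤-Reasoning
  t = part -[1+ k ] p q
  e₁ : ∀ r t q s → 2 * r + t + (q + s) ≡ (q + r) + (t + (r + s))
  e₁ = solve-∀
  e₂ : ∀ p s k q → ((p + s) + k) + (k + (p + q)) ≡ 2 * p + 2 * k + (q + s)
  e₂ = solve-∀
-- Here `q′` = `q` + `k`, which makes `k` positive and leaves 2`t` = 0 in `eq`.
tight (+ k) p q .p q′ diff eq (inj₂ (refl , q<q′)) = subst (_< k) (sym t≡0) 0<k , λ _ → t≡0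
  where
  t = part (+ k) p q
  q′≡ : q′ ≡ q + k
  q′≡ = +-cancelˡ-≡ p _ _ (trans (difference-+ {k} {p} {q} {p} {q′} diff) (e p q k))
    where
    e : ∀ p q k → (q + p) + k ≡ p + (q + k)
    e = solve-∀
  0<k : 0 < k
  0<k = n≢0⇒n>0 λ k≡0 → <⇒≢ q<q′ (sym (trans q′≡ (trans (cong (q ℕ.+_) k≡0) (+-identityʳ q))))
  t≡0 : t ≡ 0
  t≡0 = m+n≡0⇒m≡0 t (+-cancelʳ-≡ (p + q′) (2 * t) 0
    (trans (sym eq) (trans (e k p q) (cong (p ℕ.+_) (sym q′≡)))))
    where
    e : ∀ k p q → k + (p + q) ≡ p + (q + k)
    e = solve-∀
tight -[1+ k ] p q .p q′ diff eq (inj₂ (refl , q<q′)) = contradiction q<q′ (≤⇒≯ (begin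
  q′          ≤⟨ m≤m+n q′ (suc k) ⟩
  q′ + suc k  ≡⟨ +-cancelˡ-≡ p _ _ (trans (sym (+-assoc p q′ (suc k)))
                  (trans (sym (difference-- {k} {p} {q} {p} {q′} diff)) (+-comm q p))) ⟩
  q           ∎))
  where open ≤-Reasoning

parity : ∀ n → Σ ℕ λ k → (n ≡ 2 * k) ⊎ (n ≡ 2 * k + 1)
parity zero = 0 , inj₁ refl
parity (suc n) with parity n
... | k , inj₁ eq = k , inj₂ (trans (cong suc eq) (+-comm 1 (2 * k)))
... | k , inj₂ eq = suc k , inj₁ (trans (cong suc eq) (e k))
  where
  e : ∀ k → suc (2 * k + 1) ≡ 2 * suc k
  e = solve-∀

part-divides : ∀ {c ℓ} (K : Field c ℓ) {x y} n p q → x ⊑ y → n ≤ part y p q →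
  (ifPos K x n ≤ p) × (ifNeg K x n ≤ q)
part-divides K n p q zer _ = z≤n , z≤n
part-divides K n p q (pos {n = k}) n≤ = ≤-trans n≤ (m⊓n≤m p (suc k)) , z≤n
part-divides K n p q (neg {n = k}) n≤ = z≤n , ≤-trans n≤ (m⊓n≤m q (suc k))

⊑-positive : ∀ {x y} → x ⊑ y → + 0 ℤ.< x → + 0 ℤ.< y
⊑-positive zer (ℤ.+<+ ())
⊑-positive pos _ = ℤ.+<+ (s≤s z≤n)

-- Every monomial that is not smallest in its fiber is divisible by a listed initial term.

module Reduction {c ℓ} (K : Field c ℓ) {m s} (A : Matrix m s) where
  open Fibers K A public

  Reducible : Mon s → Set c
  Reducible e = Σ (Mon s) λ u → Σ (Mon s) λ v → Gens K A (binom K u v) × (∀ x → u x ≤ e x)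

  monM-divides : ∀ {u : Mon s} {a μ} → (∀ i → ifPos K (a i) (μ i) ≤ u (pv i)) →
    (∀ i → ifNeg K (a i) (μ i) ≤ u (mv i)) → ∀ x → monM K a μ x ≤ u x
  monM-divides p≤ m≤ zv = z≤n
  monM-divides p≤ m≤ (pv i) = p≤ i
  monM-divides p≤ m≤ (mv i) = m≤ i

  pair-reducible : ∀ u i → 1 ≤ u (pv i) → 1 ≤ u (mv i) → Reducible u
  pair-reducible u i 1≤p 1≤m = monPM K i , monZ2 K , inj₂ (inj₂ (inj₂ (i , refl))) , divides
    where
    divides : ∀ x → monPM K i x ≤ u x
    divides zv = z≤n
    divides (pv j) with i Fin.≟ j
    ... | yes refl = 1≤p
    ... | no _ = z≤n
    divides (mv j) with i Fin.≟ j
    ... | yes refl = 1≤m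
    ... | no _ = z≤n

  -- Quantified over all smaller shares, because the share is still to be cut down to the size that
  -- the generator prescribes.
  Divides : Mon s → (a : Fin s → ℤ) → (Fin s → ℕ) → Set
  Divides u a ν = ∀ κ → (∀ i → κ i ≤ ν i) → ∀ x → monM K a κ x ≤ u x

  odd-reducible : ∀ {u a ν} k → MinLinDep A a → SubMS a ν → Divides u a ν →
    sizeM a ≡ 2 * k + 1 → k < sumℕ ν → Reducible u
  odd-reducible {u} {a} {ν} k minimal ν≤a div odd k<
    with shrink (λ _ → 0) ν (k + 1) (λ _ → z≤n) (≤-trans (≤-reflexive (sumℕ-zero s)) z≤n)
           (subst (_≤ sumℕ ν) (+-comm 1 k) k<)
  ... | κ , _ , κ≤ν , Σκ = monM K a κ , monC K a κ 1 ,
    inj₂ (inj₁ (a , minimal , k , odd , κ , (λ i → ≤-trans (κ≤ν i) (ν≤a i)) , Σκ , refl)) , div κ κ≤ν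

  δ+δ≤ : ∀ (i : Fin s) (ν : Fin s → ℕ) → 2 ≤ ν i → ∀ j → δ i j + δ i j ≤ ν j
  δ+δ≤ i ν 2≤ j with i Fin.≟ j
  ... | yes refl = 2≤
  ... | no _ = z≤n

  sumℕ-δ+δ : ∀ (i : Fin s) → sumℕ (λ j → δ i j + δ i j) ≡ 2
  sumℕ-δ+δ i = trans (sumℕ-+ (δ i) (δ i)) (cong₂ _+_ (sumℕ-δ i) (sumℕ-δ i))

  -- At least k + 1 elements are available. Two copies of +F at the minimal index allow a binomial
  -- (3); otherwise one copy at that index can be given up, and k of the remaining elements form a
  -- binomial (1).
  even-reducible : ∀ {u a ν} k → MinLinDep A a → SubMS a ν → Divides u a ν →
    sizeM a ≡ 2 * k → k < sumℕ ν → Reducible u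
  even-reducible {u} {a} {ν} k minimal ν≤a div even k< with leastSupport a (proj₁ (proj₂ minimal))
  ... | i , min with (+ 0 ℤP.<? a i) ×-dec (2 ≤? ν i)
  ...   | yes (0<aᵢ , 2≤νᵢ) = gen3
    where
    -- Ensures that the two reserved copies fit into a share of size k + 1.
    0<k : 0 < k
    0<k = n≢0⇒n>0 λ k≡0 → <⇒≢ (nonzero-size a (proj₁ (proj₂ minimal))) (sym (trans even (cong (2 *_) k≡0)))
    gen3 : Reducible u
    gen3 with shrink (λ j → δ i j + δ i j) ν (k + 1) (δ+δ≤ i ν 2≤νᵢ)
                (subst₂ _≤_ (sym (sumℕ-δ+δ i)) (+-comm 1 k) (s≤s 0<k))
                (subst (_≤ sumℕ ν) (+-comm 1 k) k<)
    ... | κ , lo≤κ , κ≤ν , Σκ = monM K a κ , monC K a κ 2 ,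
      inj₂ (inj₂ (inj₁ (a , minimal , i , min , k , even , κ , (λ j → ≤-trans (κ≤ν j) (ν≤a j)) , Σκ ,
        0<aᵢ , subst (λ d → d + d ≤ κ i) (δ-diag i) (lo≤κ i) , refl))) , div κ κ≤ν
  ...   | no ¬gen3 = gen1
    where
    -- Giving up one copy at `i` secures both side conditions: for a positive entry at most one copy
    -- was present, so none remains; for a negative entry the share stays below the full
    -- multiplicity.
    hi : Fin s → ℕ
    hi j = ν j ∸ δ i j
    hi≤ν : ∀ j → hi j ≤ ν j
    hi≤ν j = m∸n≤m (ν j) (δ i j)
    hiᵢ : hi i ≡ ν i ∸ 1
    hiᵢ = cong (ν i ∸_) (δ-diag i)
    k≤hi : k ≤ sumℕ hi
    k≤hi = +-cancelˡ-≤ 1 _ _ (begin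
      suc k                              ≤⟨ k< ⟩
      sumℕ ν                             ≤⟨ sumℕ-mono (λ j → m≤n+m∸n (ν j) (δ i j)) ⟩
      sumℕ (λ j → δ i j + hi j)          ≡⟨ sumℕ-+ (δ i) hi ⟩
      sumℕ (δ i) + sumℕ hi               ≡⟨ cong (ℕ._+ sumℕ hi) (sumℕ-δ i) ⟩
      suc (sumℕ hi)                      ∎)
      where open ≤-Reasoning
    gen1 : Reducible u
    gen1 with shrink (λ _ → 0) hi k (λ _ → z≤n) (≤-trans (≤-reflexive (sumℕ-zero s)) z≤n) k≤hi
    ... | κ , _ , κ≤hi , Σκ = monM K a κ , monC K a κ 0 ,
      inj₁ (a , minimal , i , min , k , even , κ , (λ j → ≤-trans (κ≤ν j) (ν≤a j)) , Σκ ,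
        pos⇒0 , neg⇒< , refl) , div κ κ≤ν
      where
      κ≤ν : ∀ j → κ j ≤ ν j
      κ≤ν j = ≤-trans (κ≤hi j) (hi≤ν j)
      κᵢ≤ : κ i ≤ ν i ∸ 1
      κᵢ≤ = subst (κ i ≤_) hiᵢ (κ≤hi i)
      pos⇒0 : + 0 ℤ.< a i → κ i ≡ 0
      pos⇒0 0<aᵢ = n≤0⇒n≡0 (≤-trans κᵢ≤ (m≤n+o⇒m∸n≤o (ν i) 1 (≤-pred (≰⇒> λ 2≤ → ¬gen3 (0<aᵢ , 2≤)))))
      neg⇒< : a i ℤ.< + 0 → ¬ (∣ a i ∣ ≤ κ i)
      neg⇒< _ aᵢ≤κᵢ = proj₁ min (ℤP.∣i∣≡0⇒i≡0 (n<1⇒n≡0 (≰⇒> λ 1≤aᵢ →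
        n≮n ∣ a i ∣ (≤-<-trans (≤-trans aᵢ≤κᵢ (≤-trans κᵢ≤ (∸-monoˡ-≤ 1 (ν≤a i))))
          (∸-monoʳ-< {∣ a i ∣} {1} {0} (s≤s z≤n) 1≤aᵢ)))))

  unbalanced-reducible : ∀ {u a ν} → MinLinDep A a → SubMS a ν → Divides u a ν →
    sizeM a < 2 * sumℕ ν → Reducible u
  unbalanced-reducible {u} {a} {ν} minimal ν≤a div size< with parity (sizeM a)
  ... | k , inj₁ even = even-reducible k minimal ν≤a div even
          (*-cancelˡ-< 2 k (sumℕ ν) (subst (_< 2 * sumℕ ν) even size<))
  ... | k , inj₂ odd = odd-reducible k minimal ν≤a div odd
          (*-cancelˡ-< 2 k (sumℕ ν) (≤-<-trans (m≤m+n (2 * k) 1) (subst (_< 2 * sumℕ ν) odd size<)))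

  module Pairless {u v : Mon s} (same : img u ≡ img v)
                  (pairless : ∀ i → (u (pv i) ≡ 0) ⊎ (u (mv i) ≡ 0)) where

    w : Fin s → ℤ
    w i = net u i ℤ.- net v i

    μ : Fin s → ℕ
    μ i = part (w i) (u (pv i)) (u (mv i))

    -- An index below the whole support of `w` is the minimal index of any sign-compatible piece in
    -- whose support it lies. The second clause yields condition (a) for every share below `μ`.
    Leading : Fin s → Set
    Leading i = (∀ j → w j ≢ + 0 → i Fin.≤ j) × (+ 0 ℤ.< w i → μ i ≡ 0)

    pairs : Mon s → Fin s → ℕ
    pairs e i = e (pv i) + e (mv i)

    degrees : u zv + sumℕ (pairs u) ≡ v zv + sumℕ (pairs v)
    degrees = trans (sym (degree-split u)) (trans (img-degree u v same) (degree-split v))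

    deficits : ∀ i → ∣ w i ∣ + pairs u i ≤ 2 * μ i + pairs v i
    deficits i = deficit (w i) (u (pv i)) (u (mv i)) (v (pv i)) (v (mv i)) refl (pairless i)

    sum-left : sumℕ (λ i → ∣ w i ∣ + pairs u i) ≡ sizeM w + sumℕ (pairs u)
    sum-left = sumℕ-+ (λ i → ∣ w i ∣) (pairs u)

    sum-right : sumℕ (λ i → 2 * μ i + pairs v i) ≡ 2 * sumℕ μ + sumℕ (pairs v)
    sum-right = trans (sumℕ-+ (λ i → 2 * μ i) (pairs v)) (cong (ℕ._+ sumℕ (pairs v)) (sumℕ-double μ))

    total-deficit : sizeM w + sumℕ (pairs u) ≤ 2 * sumℕ μ + sumℕ (pairs v)
    total-deficit = subst₂ _≤_ sum-left sum-right (sumℕ-mono deficits)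

    equal-pairs : v zv ≡ u zv → sumℕ (pairs u) ≡ sumℕ (pairs v)
    equal-pairs vz≡uz = +-cancelˡ-≡ (u zv) _ _
      (trans degrees (cong (ℕ._+ sumℕ (pairs v)) vz≡uz))

    size-bound : v zv ≡ u zv → sizeM w ≤ 2 * sumℕ μ
    size-bound vz≡uz = +-cancelʳ-≤ (sumℕ (pairs u)) _ _
      (subst (λ z → sizeM w + sumℕ (pairs u) ≤ 2 * sumℕ μ + z) (sym (equal-pairs vz≡uz)) total-deficit)

    good-z : u zv < v zv → Good Leading w μ
    good-z uz<vz = inj₁ (+-cancelʳ-< (sumℕ (pairs u)) _ _
      (≤-<-trans total-deficit (+-monoʳ-< (2 * sumℕ μ) Σv<Σu)))
      where
      -- The total degrees agree, so the additional z in `v` is paid for by its other variables.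
      Σv<Σu : sumℕ (pairs v) < sumℕ (pairs u)
      Σv<Σu = +-cancelˡ-< (u zv) _ _ (<-≤-trans (+-monoˡ-< (sumℕ (pairs v)) uz<vz) (≤-reflexive (sym degrees)))

    good-pairs : v zv ≡ u zv → FirstDiff (v ∘ pv) (v ∘ mv) (u ∘ pv) (u ∘ mv) → Good Leading w μ
    good-pairs vz≡uz (i , before , diff) with m≤n⇒m<n∨m≡n (size-bound vz≡uz)
    ... | inj₁ size< = inj₁ size<
    ... | inj₂ size≡ = inj₂ (size≡ , i , ((λ j wⱼ≢0 → ≮⇒≥ λ j<i → wⱼ≢0 (agree j j<i)) , proj₂ atᵢ) ,
          proj₁ atᵢ)
      where
      -- Equality of the sums leaves no slack at any single index.
      exact : ∀ j → ∣ w j ∣ + pairs u j ≡ 2 * μ j + pairs v j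
      exact = sumℕ-≤-tight deficits (≤-reflexive (trans sum-right
        (trans (cong₂ _+_ (sym size≡) (sym (equal-pairs vz≡uz))) (sym sum-left))))
      agree : ∀ j → j Fin.< i → w j ≡ + 0
      agree j j<i = ℤP.i≡j⇒i-j≡0 (cong₂ (λ p q → + p ℤ.- + q)
        (sym (proj₁ (before j j<i))) (sym (proj₂ (before j j<i))))
      atᵢ : (μ i < ∣ w i ∣) × (+ 0 ℤ.< w i → μ i ≡ 0)
      atᵢ = tight (w i) (u (pv i)) (u (mv i)) (v (pv i)) (v (mv i)) refl (exact i) diff

    good⇒reducible : Good Leading w μ → Reducible u
    good⇒reducible good with minimal-good {C = Leading} A (suc (sizeM w)) w μ ≤-refl
                               (img-kernel same) (λ i → part≤∣∣ (w i) _ _) good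
    ... | a , ν , minimal , a⊑w , ν≤a , ν≤μ , good-a = conclude good-a
      where
      div : Divides u a ν
      div κ κ≤ν = monM-divides {u} {a} {κ} (λ i → proj₁ (both i)) (λ i → proj₂ (both i))
        where
        both : ∀ i → (ifPos K (a i) (κ i) ≤ u (pv i)) × (ifNeg K (a i) (κ i) ≤ u (mv i))
        both i = part-divides K (κ i) (u (pv i)) (u (mv i)) (a⊑w i) (≤-trans (κ≤ν i) (ν≤μ i))
      conclude : Good Leading a ν → Reducible u
      conclude (inj₁ size<) = unbalanced-reducible minimal ν≤a div size<
      -- The share is exactly half of the dependency, so it is used uncut in a binomial (1).
      conclude (inj₂ (size≡ , i , (least , pos⇒0) , νᵢ<aᵢ)) = monM K a ν , monC K a ν 0 ,
        inj₁ (a , minimal , i ,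
          ((λ aᵢ≡0 → n≮0 (subst (λ x → ν i < ∣ x ∣) aᵢ≡0 νᵢ<aᵢ)) ,
           (λ j aⱼ≢0 → least j (⊑-≢0 (a⊑w j) aⱼ≢0))) ,
          sumℕ ν , size≡ , ν , ν≤a , refl ,
          (λ 0<aᵢ → n≤0⇒n≡0 (subst (ν i ≤_) (pos⇒0 (⊑-positive (a⊑w i) 0<aᵢ)) (ν≤μ i))) ,
          (λ _ → <⇒≱ νᵢ<aᵢ) , refl) , div ν (λ i → ≤-refl)

  ≺⇒reducible : ∀ {u v} → img u ≡ img v → v ≺ u → Reducible u
  ≺⇒reducible {u} {v} same v≺u with FinP.any? (λ i → (1 ≤? u (pv i)) ×-dec (1 ≤? u (mv i)))
  ... | yes (i , 1≤p , 1≤m) = pair-reducible u i 1≤p 1≤m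
  ... | no none = first-difference v≺u
    where
    pairless : ∀ i → (u (pv i) ≡ 0) ⊎ (u (mv i) ≡ 0)
    pairless i with 1 ≤? u (pv i)
    ... | no ≱ = inj₁ (n<1⇒n≡0 (≰⇒> ≱))
    ... | yes 1≤p = inj₂ (n<1⇒n≡0 (≰⇒> λ 1≤m → none (i , 1≤p , 1≤m)))
    open Pairless {u} {v} same pairless
    first-difference : v ≺ u → Reducible u
    first-difference (inj₁ lt) = contradiction (sym (img-degree u v same)) (<⇒≢ lt)
    first-difference (inj₂ (_ , lt)) with subst₂ _≺rev_ (expList-interleave v) (expList-interleave u) lt
    ... | inj₁ uz<vz = good⇒reducible (good-z uz<vz)
    ... | inj₂ (vz≡uz , rest) = good⇒reducible (good-pairs vz≡uz (≺rev⇒firstDiff rest))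

-- Coefficients of term lists under an arbitrary key, used for exponents and for toric images.

module Coefficients {c ℓ} (K : Field c ℓ) {X E : Set} (_≟ᴱ_ : DecidableEquality E) (key : X → E) where
  open Field K using (Carrier; _≈_; 0#; 1#; setoid)
    renaming (_+_ to _⊕_; -_ to ⊖_; refl to ≈-refl; sym to ≈-sym; trans to ≈-trans;
      +-assoc to ⊕-assoc; +-cong to ⊕-cong;
      +-congˡ to ⊕-congˡ; +-congʳ to ⊕-congʳ;
      +-identityˡ to ⊕-identityˡ; +-identityʳ to ⊕-identityʳ; -‿cong to ⊖-cong; -‿inverseˡ to ⊖-inverseˡ)
  open RingProperties (Field.ring K) using (-0#≈0#)
  open CommutativeSemigroupProperties (Field.+-commutativeSemigroup K) using (x∙yz≈y∙xz)
  open import Relation.Binary.Reasoning.Setoid setoid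

  co : List (Carrier × X) → E → Carrier
  co = coeffGen K _≟ᴱ_ key

  one : Carrier → X → E → Carrier
  one a x = co ((a , x) ∷ [])

  co-∷ : ∀ a x p e → co ((a , x) ∷ p) e ≈ one a x e ⊕ co p e
  co-∷ a x p e with key x ≟ᴱ e
  ... | yes _ = ⊕-congʳ (≈-sym (⊕-identityʳ a))
  ... | no _ = ≈-sym (⊕-identityˡ _)

  co-++ : ∀ p q e → co (p ++ q) e ≈ co p e ⊕ co q e
  co-++ [] q e = ≈-sym (⊕-identityˡ _)
  co-++ ((a , x) ∷ p) q e = begin
    co ((a , x) ∷ p ++ q) e              ≈⟨ co-∷ a x (p ++ q) e ⟩
    one a x e ⊕ co (p ++ q) e            ≈⟨ ⊕-congˡ (co-++ p q e) ⟩
    one a x e ⊕ (co p e ⊕ co q e)        ≈⟨ ⊕-assoc _ _ _ ⟨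
    (one a x e ⊕ co p e) ⊕ co q e        ≈⟨ ⊕-congʳ (co-∷ a x p e) ⟨
    co ((a , x) ∷ p) e ⊕ co q e          ∎

  one-hit : ∀ a {x e} → key x ≡ e → one a x e ≈ a
  one-hit a {x} {e} hit with key x ≟ᴱ e
  ... | yes _ = ⊕-identityʳ a
  ... | no miss = contradiction hit miss

  one-miss : ∀ a {x e} → key x ≢ e → one a x e ≈ 0#
  one-miss a {x} {e} miss with key x ≟ᴱ e
  ... | yes hit = contradiction hit miss
  ... | no _ = ≈-refl

  one-cong : ∀ {a b x y} e → a ≈ b → key x ≡ key y → one a x e ≈ one b y e
  one-cong {a} {b} {x} {y} e a≈b x≡y with key x ≟ᴱ e
  ... | yes hit = ≈-trans (⊕-identityʳ a) (≈-trans a≈b (≈-sym (one-hit b (trans (sym x≡y) hit))))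
  ... | no miss = ≈-sym (one-miss b (λ hit → miss (trans x≡y hit)))

  one-+ : ∀ a b x e → one (a ⊕ b) x e ≈ one a x e ⊕ one b x e
  one-+ a b x e with key x ≟ᴱ e
  ... | yes _ = ≈-trans (⊕-identityʳ _) (≈-sym (⊕-cong (⊕-identityʳ a) (⊕-identityʳ b)))
  ... | no _ = ≈-sym (⊕-identityˡ 0#)

  one-neg : ∀ a x e → one (⊖ a) x e ≈ ⊖ one a x e
  one-neg a x e with key x ≟ᴱ e
  ... | yes _ = ≈-trans (⊕-identityʳ _) (⊖-cong (≈-sym (⊕-identityʳ a)))
  ... | no _ = ≈-sym -0#≈0#

  one-zero : ∀ {a} x e → a ≈ 0# → one a x e ≈ 0#
  one-zero x e a≈0 with key x ≟ᴱ e
  ... | yes _ = ≈-trans (⊕-identityʳ _) a≈0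
  ... | no _ = ≈-refl

  co-absent : ∀ p e → ¬ Any (λ t → key (proj₂ t) ≡ e) p → co p e ≈ 0#
  co-absent [] e _ = ≈-refl
  co-absent ((a , x) ∷ p) e absent = ≈-trans (co-∷ a x p e)
    (≈-trans (⊕-cong (one-miss a (absent ∘ here)) (co-absent p e (absent ∘ there))) (⊕-identityˡ 0#))

  cancel : ∀ a x p e → co ((⊖ a , x) ∷ (a , x) ∷ p) e ≈ co p e
  cancel a x p e = begin
    co ((⊖ a , x) ∷ (a , x) ∷ p) e          ≈⟨ co-∷ (⊖ a) x _ e ⟩
    one (⊖ a) x e ⊕ co ((a , x) ∷ p) e      ≈⟨ ⊕-congˡ (co-∷ a x p e) ⟩
    one (⊖ a) x e ⊕ (one a x e ⊕ co p e)    ≈⟨ ⊕-assoc _ _ _ ⟨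
    (one (⊖ a) x e ⊕ one a x e) ⊕ co p e    ≈⟨ ⊕-congʳ (⊕-congʳ (one-neg a x e)) ⟩
    (⊖ one a x e ⊕ one a x e) ⊕ co p e      ≈⟨ ⊕-congʳ (⊖-inverseˡ _) ⟩
    0# ⊕ co p e                             ≈⟨ ⊕-identityˡ _ ⟩
    co p e                                  ∎

  exchange : ∀ a x b y p e → co ((a , x) ∷ (b , y) ∷ p) e ≈ co ((b , y) ∷ (a , x) ∷ p) e
  exchange a x b y p e = begin
    co ((a , x) ∷ (b , y) ∷ p) e          ≈⟨ co-∷ a x _ e ⟩
    one a x e ⊕ co ((b , y) ∷ p) e        ≈⟨ ⊕-congˡ (co-∷ b y p e) ⟩
    one a x e ⊕ (one b y e ⊕ co p e)      ≈⟨ x∙yz≈y∙xz _ _ _ ⟩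
    one b y e ⊕ (one a x e ⊕ co p e)      ≈⟨ ⊕-congˡ (co-∷ a x p e) ⟨
    one b y e ⊕ co ((a , x) ∷ p) e        ≈⟨ co-∷ b y _ e ⟨
    co ((b , y) ∷ (a , x) ∷ p) e          ∎

  collect : ∀ a b x p e → co ((a , x) ∷ (b , x) ∷ p) e ≈ co ((a ⊕ b , x) ∷ p) e
  collect a b x p e = begin
    co ((a , x) ∷ (b , x) ∷ p) e          ≈⟨ co-∷ a x _ e ⟩
    one a x e ⊕ co ((b , x) ∷ p) e        ≈⟨ ⊕-congˡ (co-∷ b x p e) ⟩
    one a x e ⊕ (one b x e ⊕ co p e)      ≈⟨ ⊕-assoc _ _ _ ⟨
    (one a x e ⊕ one b x e) ⊕ co p e      ≈⟨ ⊕-congʳ (one-+ a b x e) ⟨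
    one (a ⊕ b) x e ⊕ co p e              ≈⟨ co-∷ (a ⊕ b) x p e ⟨
    co ((a ⊕ b , x) ∷ p) e                ∎

  co-∷-cong : ∀ a x {p q} e → co p e ≈ co q e → co ((a , x) ∷ p) e ≈ co ((a , x) ∷ q) e
  co-∷-cong a x {p} {q} e eq = ≈-trans (co-∷ a x p e) (≈-trans (⊕-congˡ eq) (≈-sym (co-∷ a x q e)))

  co-drop : ∀ {a x} p e → a ≈ 0# → co ((a , x) ∷ p) e ≈ co p e
  co-drop {a} {x} p e a≈0 = ≈-trans (co-∷ a x p e) (≈-trans (⊕-congʳ (one-zero x e a≈0)) (⊕-identityˡ _))

  remove : E → List (Carrier × X) → List (Carrier × X)
  remove e [] = []
  remove e ((a , x) ∷ p) with key x ≟ᴱ e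
  ... | yes _ = remove e p
  ... | no _ = (a , x) ∷ remove e p

  length-remove : ∀ e p → List.length (remove e p) ≤ List.length p
  length-remove e [] = z≤n
  length-remove e ((a , x) ∷ p) with key x ≟ᴱ e
  ... | yes _ = m≤n⇒m≤1+n (length-remove e p)
  ... | no _ = s≤s (length-remove e p)

  length-remove-head : ∀ a x p → List.length (remove (key x) ((a , x) ∷ p)) ≤ List.length p
  length-remove-head a x p with key x ≟ᴱ key x
  ... | yes _ = length-remove (key x) p
  ... | no x≢x = contradiction refl x≢x

  remove-hit : ∀ e p → co (remove e p) e ≈ 0#
  remove-hit e [] = ≈-refl
  remove-hit e ((a , x) ∷ p) with key x ≟ᴱ e
  ... | yes _ = remove-hit e p
  ... | no miss = ≈-trans (co-∷ a x (remove e p) e)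
    (≈-trans (⊕-cong (one-miss a miss) (remove-hit e p)) (⊕-identityˡ 0#))

  remove-miss : ∀ {d e} p → d ≢ e → co (remove e p) d ≈ co p d
  remove-miss [] _ = ≈-refl
  remove-miss {d} {e} ((a , x) ∷ p) d≢e with key x ≟ᴱ e
  ... | yes hit = ≈-trans (remove-miss p d≢e) (≈-trans (≈-sym (⊕-identityˡ _))
    (≈-trans (⊕-congʳ (≈-sym (one-miss a (λ hit′ → d≢e (trans (sym hit′) hit))))) (≈-sym (co-∷ a x p d))))
  ... | no _ = ≈-trans (co-∷ a x (remove e p) d)
    (≈-trans (⊕-congˡ (remove-miss p d≢e)) (≈-sym (co-∷ a x p d)))

-- Congruence modulo the ideal generated by `G`.

module Ideals {c ℓ} (K : Field c ℓ) {s} {g} (G : Poly K s → Set g) where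
  open Field K using (Carrier; _≈_; 0#; 1#; setoid)
    renaming (_+_ to _⊕_; _*_ to _⊛_; -_ to ⊖_; refl to ≈-refl; sym to ≈-sym; trans to ≈-trans;
      *-identityʳ to ⊛-identityʳ; +-assoc to ⊕-assoc; +-comm to ⊕-comm; +-cong to ⊕-cong;
      +-congˡ to ⊕-congˡ; +-congʳ to ⊕-congʳ;
      +-identityˡ to ⊕-identityˡ; +-identityʳ to ⊕-identityʳ; -‿cong to ⊖-cong; -‿inverseˡ to ⊖-inverseˡ)
  open RingProperties (Field.ring K) using (-‿distribʳ-*)
  open import Relation.Binary.Reasoning.Setoid setoid
  open Coefficients K {Mon s} (ListP.≡-dec _≟_) expList

  combination : List (Poly K s × Poly K s) → Poly K s
  combination = List.foldr (λ hg acc → _*P_ K (proj₁ hg) (proj₂ hg) ++ acc) []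

  combination-++ : ∀ L L′ k → co (combination (L ++ L′)) k ≈ co (combination L) k ⊕ co (combination L′) k
  combination-++ [] L′ k = ≈-sym (⊕-identityˡ _)
  combination-++ ((h , g) ∷ L) L′ k = begin
    co (_*P_ K h g ++ combination (L ++ L′)) k                    ≈⟨ co-++ (_*P_ K h g) _ k ⟩
    co (_*P_ K h g) k ⊕ co (combination (L ++ L′)) k              ≈⟨ ⊕-congˡ (combination-++ L L′ k) ⟩
    co (_*P_ K h g) k ⊕ (co (combination L) k ⊕ co (combination L′) k)  ≈⟨ ⊕-assoc _ _ _ ⟨
    (co (_*P_ K h g) k ⊕ co (combination L) k) ⊕ co (combination L′) k  ≈⟨ ⊕-congʳ (co-++ (_*P_ K h g) _ k) ⟨
    co (combination ((h , g) ∷ L)) k ⊕ co (combination L′) k      ∎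

  infix 4 _∼_
  -- Says that p - q lies in the ideal, with `q` moved to the other side so that only sums of term
  -- lists occur.
  record _∼_ (p q : Poly K s) : Set (c ⊔ ℓ ⊔ g) where
    constructor modulo
    field
      multiples : List (Poly K s × Poly K s)
      generated : All (λ hg → G (proj₂ hg)) multiples
      equal : ∀ k → co p k ≈ co (combination multiples) k ⊕ co q k

  ≈⇒∼ : ∀ {p q} → (∀ k → co p k ≈ co q k) → p ∼ q
  ≈⇒∼ p≈q = modulo [] [] λ k → ≈-trans (p≈q k) (≈-sym (⊕-identityˡ _))

  ∼-trans : ∀ {p q r} → p ∼ q → q ∼ r → p ∼ r
  ∼-trans {p} {q} {r} (modulo L GL p∼q) (modulo L′ GL′ q∼r) =
    modulo (L ++ L′) (AllP.++⁺ GL GL′) λ k → begin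
    co p k                                                     ≈⟨ p∼q k ⟩
    co (combination L) k ⊕ co q k                              ≈⟨ ⊕-congˡ (q∼r k) ⟩
    co (combination L) k ⊕ (co (combination L′) k ⊕ co r k)    ≈⟨ ⊕-assoc _ _ _ ⟨
    (co (combination L) k ⊕ co (combination L′) k) ⊕ co r k    ≈⟨ ⊕-congʳ (combination-++ L L′ k) ⟨
    co (combination (L ++ L′)) k ⊕ co r k                      ∎

  ∼-++ʳ : ∀ {p q} r → p ∼ q → p ++ r ∼ q ++ r
  ∼-++ʳ {p} {q} r (modulo L GL p∼q) = modulo L GL λ k → begin
    co (p ++ r) k                                 ≈⟨ co-++ p r k ⟩
    co p k ⊕ co r k                               ≈⟨ ⊕-congʳ (p∼q k) ⟩
    (co (combination L) k ⊕ co q k) ⊕ co r k      ≈⟨ ⊕-assoc _ _ _ ⟩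
    co (combination L) k ⊕ (co q k ⊕ co r k)      ≈⟨ ⊕-congˡ (co-++ q r k) ⟨
    co (combination L) k ⊕ co (q ++ r) k          ∎

  ++-comm : ∀ p q → p ++ q ∼ q ++ p
  ++-comm p q = ≈⇒∼ λ k → ≈-trans (co-++ p q k) (≈-trans (⊕-comm _ _) (≈-sym (co-++ q p k)))

  ∼-++ˡ : ∀ {p q} r → p ∼ q → r ++ p ∼ r ++ q
  ∼-++ˡ {p} {q} r p∼q = ∼-trans (++-comm r p)
    (∼-trans (∼-++ʳ r p∼q) (++-comm q r))

  ∼[]⇒InIdeal : ∀ {f} → f ∼ [] → InIdeal K G f
  ∼[]⇒InIdeal (modulo L GL f∼) = L , GL , λ e → ≈-trans (f∼ (expList e)) (⊕-identityʳ _)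

  _≈ᴹ_ : Mon s → Mon s → Set (c ⊔ ℓ ⊔ g)
  e ≈ᴹ e′ = ∀ a → (a , e) ∷ [] ∼ (a , e′) ∷ []

  ≈ᴹ-reflexive : ∀ {e e′} → expList e ≡ expList e′ → e ≈ᴹ e′
  ≈ᴹ-reflexive eq a = ≈⇒∼ λ k → one-cong k ≈-refl eq

  ≈ᴹ-trans : ∀ {e e′ e″} → e ≈ᴹ e′ → e′ ≈ᴹ e″ → e ≈ᴹ e″
  ≈ᴹ-trans e∼e′ e′∼e″ a = ∼-trans (e∼e′ a) (e′∼e″ a)

  -- No multiplier is negated. Instead a·e′ is written as -a·e + a·e′ + a·e, its first term is
  -- replaced by -a·e′, and that cancels. This uses the congruence for the coefficient -a, hence the
  -- quantifier over coefficients in `_≈ᴹ_`.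
  ≈ᴹ-sym : ∀ {e e′} → e ≈ᴹ e′ → e′ ≈ᴹ e
  ≈ᴹ-sym {e} {e′} e∼e′ a =
    ∼-trans (≈⇒∼ insert)
      (∼-trans (∼-++ʳ rest (e∼e′ (⊖ a)))
        (≈⇒∼ (cancel a e′ ((a , e) ∷ []))))
    where
    rest : Poly K s
    rest = (a , e′) ∷ (a , e) ∷ []
    insert : ∀ k → co ((a , e′) ∷ []) k ≈ co ((⊖ a , e) ∷ rest) k
    insert k = ≈-sym (≈-trans (co-∷-cong (⊖ a) e k (exchange a e′ a e [] k))
                        (cancel a e ((a , e′) ∷ []) k))

  mul-quotient : ∀ {e : Mon s} u → (∀ x → u x ≤ e x) → expList (mulMon (λ x → e x ∸ u x) u) ≡ expList e
  mul-quotient u u≤e = expList-cong (λ x → m∸n+n≡m (u≤e x))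

  -- One rewriting step: the difference of the two terms is the binomial times `a` and the quotient
  -- monomial `r` of `e` by `u`.
  binom-≈ᴹ : ∀ {e u v} → G (binom K u v) → (∀ x → u x ≤ e x) → e ≈ᴹ mulMon (λ x → e x ∸ u x) v
  binom-≈ᴹ {e} {u} {v} Guv u≤e a =
    modulo ((((a , r) ∷ []) , binom K u v) ∷ []) (Guv ∷ []) λ k → ≈-sym (begin
      co (_*P_ K ((a , r) ∷ []) (binom K u v) ++ []) k ⊕ one a (mulMon r v) k
        ≈⟨ ⊕-congʳ (expand k) ⟩
      (one a e k ⊕ ⊖ one a (mulMon r v) k) ⊕ one a (mulMon r v) k
        ≈⟨ ⊕-assoc _ _ _ ⟩
      one a e k ⊕ (⊖ one a (mulMon r v) k ⊕ one a (mulMon r v) k)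
        ≈⟨ ⊕-congˡ (⊖-inverseˡ _) ⟩
      one a e k ⊕ 0#
        ≈⟨ ⊕-identityʳ _ ⟩
      one a e k ∎)
    where
    r : Mon s
    r x = e x ∸ u x
    negated : a ⊛ (⊖ 1#) ≈ ⊖ a
    negated = ≈-trans (≈-sym (-‿distribʳ-* a 1#)) (⊖-cong (⊛-identityʳ a))
    expand : ∀ k → co (_*P_ K ((a , r) ∷ []) (binom K u v) ++ []) k ≈ one a e k ⊕ ⊖ one a (mulMon r v) k
    expand k = begin
      co (_*P_ K ((a , r) ∷ []) (binom K u v) ++ []) k          ≈⟨ co-∷ (a ⊛ 1#) (mulMon r u) _ k ⟩
      one (a ⊛ 1#) (mulMon r u) k ⊕ one (a ⊛ (⊖ 1#)) (mulMon r v) k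
        ≈⟨ ⊕-cong (one-cong k (⊛-identityʳ a) (mul-quotient u u≤e)) (one-cong k negated refl) ⟩
      one a e k ⊕ one (⊖ a) (mulMon r v) k                      ≈⟨ ⊕-congˡ (one-neg a _ k) ⟩
      one a e k ⊕ ⊖ one a (mulMon r v) k                        ∎

  monomial-InIdeal : ∀ {e u} → G (monomial K u) → (∀ x → u x ≤ e x) → InIdeal K G (monomial K e)
  monomial-InIdeal {e} {u} Gu u≤e =
    (monomial K (λ x → e x ∸ u x) , monomial K u) ∷ [] , Gu ∷ [] ,
    λ k → one-cong (expList k) (≈-sym (⊛-identityʳ 1#)) (sym (mul-quotient u u≤e))

-- The listed binomials generate the toric ideal and its initial ideal.

module Groebner {c ℓ} (K : Field c ℓ) {m s} (A : Matrix m s) where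
  open Field K using (Carrier; _≈_; 0#; 1#; setoid; 0≉1)
    renaming (_+_ to _⊕_; -_ to ⊖_; refl to ≈-refl; sym to ≈-sym; trans to ≈-trans;
      +-cong to ⊕-cong; +-congˡ to ⊕-congˡ; +-congʳ to ⊕-congʳ;
      +-identityˡ to ⊕-identityˡ; +-identityʳ to ⊕-identityʳ; -‿cong to ⊖-cong;
      -‿inverseˡ to ⊖-inverseˡ; -‿inverseʳ to ⊖-inverseʳ)
  open RingProperties (Field.ring K) using (-0#≈0#; -‿involutive)
  open import Relation.Binary.Reasoning.Setoid setoid
  open Reduction K A
  open Ideals K (Gens K A)

  _≟ᴵ_ : DecidableEquality (Vec ℤ m × ℕ)
  _≟ᴵ_ = ProdP.≡-dec (VecP.≡-dec ℤP._≟_) _≟_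

  module Mono = Coefficients K {Mon s} (ListP.≡-dec _≟_) expList
  module Fib = Coefficients K _≟ᴵ_ img

  img-expList : ∀ {e e′} → expList e ≡ expList e′ → img e ≡ img e′
  img-expList eq = img-cong (expList-injective eq)

  binom-injective : ∀ {u v u′ v′ : Mon s} → binom K u v ≡ binom K u′ v′ → (u ≡ u′) × (v ≡ v′)
  binom-injective eq with ListP.∷-injective eq
  ... | head , tail = cong proj₂ head , cong proj₂ (proj₁ (ListP.∷-injective tail))

  gen⇒reduces : ∀ {u v} → Gens K A (binom K u v) → Reduces u v
  gen⇒reduces gen with gens-reduce gen
  ... | u′ , v′ , eq , red with binom-injective eq
  ...   | refl , refl = red

  ≺-respˡ : ∀ {e e′ f : Mon s} → expList e ≡ expList e′ → e ≺ f → e′ ≺ f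
  ≺-respˡ {f = f} eq = subst (λ l → (sumL l < degree f) ⊎ ((sumL l ≡ degree f) × (l ≺rev expList f))) eq

  gens⊆toric : ∀ p → Gens K A p → ToricIdeal K A p
  gens⊆toric p gen w with gens-reduce gen
  ... | u , v , refl , same , _ = begin
    Fib.co (binom K u v) w                   ≈⟨ Fib.co-∷ 1# u _ w ⟩
    Fib.one 1# u w ⊕ Fib.one (⊖ 1#) v w      ≈⟨ ⊕-cong (Fib.one-cong w ≈-refl same) (Fib.one-neg 1# v w) ⟩
    Fib.one 1# v w ⊕ ⊖ Fib.one 1# v w        ≈⟨ ⊖-inverseʳ _ ⟩
    0#                                       ∎

  reduces⇒initial : ∀ {u v} → Reduces u v → IsInitial K (binom K u v) u
  reduces⇒initial {u} {v} (same , v≺u) = nonzero , bounded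
    where
    v≢u : expList v ≢ expList u
    v≢u = ≺⇒≢ {e = v} {u} v≺u
    leading : coeff K (binom K u v) u ≈ 1#
    leading = ≈-trans (Mono.co-∷ 1# u _ (expList u))
      (≈-trans (⊕-cong (Mono.one-hit 1# {u} refl) (Mono.one-miss (⊖ 1#) v≢u)) (⊕-identityʳ 1#))
    nonzero : ¬ (coeff K (binom K u v) u ≈ 0#)
    nonzero lead≈0 = 0≉1 (≈-trans (≈-sym lead≈0) leading)
    bounded : ∀ e → ¬ (coeff K (binom K u v) e ≈ 0#) → (expList e ≡ expList u) ⊎ (e ≺ u)
    bounded e e≉0 with ListP.≡-dec _≟_ (expList e) (expList u) | ListP.≡-dec _≟_ (expList e) (expList v)
    ... | yes e≡u | _ = inj₁ e≡u
    ... | no _ | yes e≡v = inj₂ (≺-respˡ {v} {e} {u} (sym e≡v) v≺u)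
    ... | no e≢u | no e≢v = contradiction
      (Mono.co-absent (binom K u v) (expList e)
        λ { (here u≡e) → e≢u (sym u≡e) ; (there (here v≡e)) → e≢v (sym v≡e) ; (there (there ())) })
      e≉0

  reduce-step : ∀ {e u v} → Reduces u v → (∀ x → u x ≤ e x) →
    (img e ≡ img (mulMon (λ x → e x ∸ u x) v)) × (height (mulMon (λ x → e x ∸ u x) v) < height e)
  reduce-step {e} {u} {v} (same , v≺u) u≤e = same′ , height-mono (sym (img-degree e _ same′))
    (subst (λ l → (degree rv < sumL l) ⊎ ((degree rv ≡ sumL l) × (expList rv ≺rev l)))
      (mul-quotient u u≤e) (≺-mul r v≺u))
    where
    r rv : Mon s
    r x = e x ∸ u x
    rv = mulMon r v
    same′ : img e ≡ img rv
    same′ = trans (img-expList (sym (mul-quotient u u≤e))) (img-mul r same)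

  -- Two monomials of one fiber are always comparable. Unless they are equal, the larger one is
  -- reducible, and rewriting it stays in the fiber and lowers the sum of the heights.
  connected : ∀ n e e′ → height e + height e′ < n → img e ≡ img e′ → e ≈ᴹ e′
  connected (suc n) e e′ (s≤s bound) same with ≺-cmp e e′ (img-degree e e′ same)
  ... | inj₂ (inj₁ eq) = ≈ᴹ-reflexive {e} {e′} eq
  ... | inj₁ e≺e′ with ≺⇒reducible (sym same) e≺e′
  ...   | u , v , gen , u≤e′ = ≈ᴹ-trans {e} {e″} {e′}
          (connected n e e″ (<-≤-trans (+-monoʳ-< (height e) (proj₂ step)) bound)
            (trans same (proj₁ step)))
          (≈ᴹ-sym {e′} {e″} (binom-≈ᴹ gen u≤e′))
    where
    e″ : Mon s
    e″ = mulMon (λ x → e′ x ∸ u x) v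
    step : (img e′ ≡ img e″) × (height e″ < height e′)
    step = reduce-step {e′} {u} {v} (gen⇒reduces gen) u≤e′
  connected (suc n) e e′ (s≤s bound) same | inj₂ (inj₂ e′≺e) with ≺⇒reducible same e′≺e
  ...   | u , v , gen , u≤e = ≈ᴹ-trans {e} {e″} {e′} (binom-≈ᴹ gen u≤e)
          (connected n e″ e′ (<-≤-trans (+-monoˡ-< (height e′) (proj₂ step)) bound)
            (trans (sym (proj₁ step)) same))
    where
    e″ : Mon s
    e″ = mulMon (λ x → e x ∸ u x) v
    step : (img e ≡ img e″) × (height e″ < height e)
    step = reduce-step {e} {u} {v} (gen⇒reduces gen) u≤e

  -- Modulo the binomials, all terms of `p` in the fiber of `e` collapse to one term at `e`. Its
  -- coefficient is a coefficient of the toric image, so it vanishes for members of the toric ideal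
  -- and the whole fiber drops out.
  gather : ∀ p e → p ∼ (Fib.co p (img e) , e) ∷ Fib.remove (img e) p
  gather [] e = ≈⇒∼ λ k → ≈-sym (Mono.one-zero e k ≈-refl)
  gather ((a , x) ∷ p) e with img x ≟ᴵ img e
  ... | yes same = ∼-trans (∼-++ʳ p (connected _ x e ≤-refl same a))
    (∼-trans (∼-++ˡ ((a , e) ∷ []) (gather p e)) (≈⇒∼ (Mono.collect a _ e (Fib.remove (img e) p))))
  ... | no _ = ∼-trans (∼-++ˡ ((a , x) ∷ []) (gather p e)) (≈⇒∼ (Mono.exchange a x _ e (Fib.remove (img e) p)))

  remove-toric : ∀ p w → ToricIdeal K A p → ToricIdeal K A (Fib.remove w p)
  remove-toric p w p∈I w′ with w′ ≟ᴵ w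
  ... | yes refl = Fib.remove-hit w p
  ... | no w′≢w = ≈-trans (Fib.remove-miss p w′≢w) (p∈I w′)

  toric⇒∼[] : ∀ n p → List.length p < n → ToricIdeal K A p → p ∼ []
  toric⇒∼[] (suc n) [] _ _ = ≈⇒∼ λ k → ≈-refl
  toric⇒∼[] (suc n) p@((a , x) ∷ p′) (s≤s len) p∈I =
    ∼-trans (gather p x) (∼-trans (≈⇒∼ λ k → Mono.co-drop _ k (p∈I (img x)))
      (toric⇒∼[] n (Fib.remove (img x) p) (≤-trans (s≤s (Fib.length-remove-head a x p′)) len)
        (remove-toric p (img x) p∈I)))

  -- Repeated terms with the exponents of `x` share one image, so merging them into a single term
  -- leaves every coefficient of the image unchanged.
  coarsen : ∀ p x w → Fib.co p w ≈ Fib.co ((Mono.co p (expList x) , x) ∷ Mono.remove (expList x) p) w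
  coarsen [] x w = ≈-sym (Fib.one-zero x w ≈-refl)
  coarsen ((a , y) ∷ p) x w with ListP.≡-dec _≟_ (expList y) (expList x)
  ... | yes y≡x = begin
    Fib.co ((a , y) ∷ p) w                                    ≈⟨ Fib.co-∷ a y p w ⟩
    Fib.one a y w ⊕ Fib.co p w
      ≈⟨ ⊕-cong (Fib.one-cong w ≈-refl (img-expList y≡x)) (coarsen p x w) ⟩
    Fib.one a x w ⊕ Fib.co ((Mono.co p (expList x) , x) ∷ Mono.remove (expList x) p) w
                                                              ≈⟨ Fib.co-∷ a x _ w ⟨
    Fib.co ((a , x) ∷ (Mono.co p (expList x) , x) ∷ Mono.remove (expList x) p) w
                                                              ≈⟨ Fib.collect a _ x _ w ⟩
    Fib.co ((a ⊕ Mono.co p (expList x) , x) ∷ Mono.remove (expList x) p) w ∎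
  ... | no _ = ≈-trans (Fib.co-∷-cong a y w (coarsen p x w)) (Fib.exchange a y _ x _ w)

  -- A coefficient of the image is the sum of the coefficients over its fiber. One exponent is split
  -- off at a time, and finitely many doubly negated equations combine to one.
  fiber-vanishes : ∀ n p w → List.length p < n → (∀ x → img x ≡ w → ¬ ¬ (coeff K p x ≈ 0#)) →
    ¬ ¬ (Fib.co p w ≈ 0#)
  fiber-vanishes (suc n) [] w _ _ ≉0 = ≉0 ≈-refl
  fiber-vanishes (suc n) p@((a , x) ∷ p′) w (s≤s len) vanish ≉0 =
    fiber-vanishes n rest w (≤-trans (s≤s (Mono.length-remove-head a x p′)) len) vanish-rest
      λ rest≈0 → head λ head≈0 → ≉0 (≈-trans (coarsen p x w)
        (≈-trans (Fib.co-∷ _ x rest w) (≈-trans (⊕-cong head≈0 rest≈0) (⊕-identityˡ 0#))))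
    where
    rest : Poly K s
    rest = Mono.remove (expList x) p
    head : ¬ ¬ (Fib.one (coeff K p x) x w ≈ 0#)
    head ≉ with img x ≟ᴵ w
    ... | yes x↦w = vanish x x↦w λ ≈0 → ≉ (≈-trans (⊕-identityʳ _) ≈0)
    ... | no _ = ≉ ≈-refl
    vanish-rest : ∀ y → img y ≡ w → ¬ ¬ (coeff K rest y ≈ 0#)
    vanish-rest y y↦w ≉ with ListP.≡-dec _≟_ (expList y) (expList x)
    ... | yes y≡x = ≉ (subst (λ k → Mono.co rest k ≈ 0#) (sym y≡x) (Mono.remove-hit (expList x) p))
    ... | no y≢x = vanish y y↦w λ ≈0 → ≉ (≈-trans (Mono.remove-miss p y≢x) ≈0)

  Smaller : Mon s → Carrier × Mon s → Set
  Smaller e (_ , x) = (img x ≡ img e) × (x ≺ e)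

  smaller? : ∀ f e → Dec (Any (Smaller e) f)
  smaller? f e = any? (λ (_ , x) → (img x ≟ᴵ img e) ×-dec ≺? x e) f

  -- Otherwise subtracting the term of e from f leaves a polynomial that vanishes on the fiber of e,
  -- whereas its coefficients there sum to minus the coefficient of e.
  initial-not-minimal : ∀ f e → ToricIdeal K A f → IsInitial K f e → ¬ ¬ Any (Smaller e) f
  initial-not-minimal f e f∈I (e≉0 , bounded) none =
    fiber-vanishes _ g (img e) ≤-refl vanish λ fiber≈0 → e≉0 (begin
      a                                        ≈⟨ -‿involutive a ⟨
      ⊖ ⊖ a                                    ≈⟨ ⊖-cong (begin
        ⊖ a                                      ≈⟨ ⊕-identityʳ _ ⟨
        ⊖ a ⊕ 0#                                 ≈⟨ ⊕-cong (Fib.one-hit (⊖ a) {e} refl) (f∈I (img e)) ⟨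
        Fib.one (⊖ a) e (img e) ⊕ Fib.co f (img e) ≈⟨ Fib.co-∷ (⊖ a) e f (img e) ⟨
        Fib.co g (img e)                         ≈⟨ fiber≈0 ⟩
        0#                                       ∎) ⟩
      ⊖ 0#                                     ≈⟨ -0#≈0# ⟩
      0#                                       ∎)
    where
    a : Carrier
    a = coeff K f e
    g : Poly K s
    g = (⊖ a , e) ∷ f
    vanish : ∀ x → img x ≡ img e → ¬ ¬ (coeff K g x ≈ 0#)
    vanish x x~e g≉0 with ListP.≡-dec _≟_ (expList e) (expList x)
    ... | yes e≡x = g≉0 (≈-trans (⊕-congˡ (Field.reflexive K (cong (Mono.co f) (sym e≡x)))) (⊖-inverseˡ a))
    ... | no e≢x = vanish-f λ f≈0 → g≉0 f≈0
      where
      vanish-f : ¬ ¬ (coeff K f x ≈ 0#)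
      vanish-f f≉0 with bounded x f≉0
      ... | inj₁ x≡e = e≢x (sym x≡e)
      ... | inj₂ x≺e = f≉0 (Mono.co-absent f (expList x) λ occurs →
        none (Any.map (λ {t} → below {t}) occurs))
        where
        below : ∀ {t} → expList (proj₂ t) ≡ expList x → Smaller e t
        below y≡x = trans (img-expList y≡x) x~e , ≺-respˡ {x} {_} {e} (sym y≡x) x≺e

  toric-initial : ∀ f e → ToricIdeal K A f → IsInitial K f e →
    InIdeal K (InitSet K (Gens K A)) (monomial K e)
  toric-initial f e f∈I init with smaller? f e
  -- Deciding over the listed terms removes the double negation. The term found may have total
  -- coefficient zero; only its image and its position in the order matter for reducibility.
  ... | no none = contradiction none (initial-not-minimal f e f∈I init)
  ... | yes found with find found
  ...   | (_ , x) , _ , same , x≺e with ≺⇒reducible (sym same) x≺e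
  ...     | u , v , gen , u≤e = Ideals.monomial-InIdeal K (InitSet K (Gens K A))
              (binom K u v , u , gen , reduces⇒initial (gen⇒reduces gen) , refl) u≤e

theorem4p1 : ∀ {c ℓ} (K : Field c ℓ) {m s : _} (A : Matrix m s) → Saturated A →
    IsGroebnerBasis K (ToricIdeal K A) (Gens K A) ×
    (∀ u v → Gens K A (binom K u v) → IsInitial K (binom K u v) u)
theorem4p1 K A _ =
  ( Groebner.gens⊆toric K A
  , (λ f f∈I → Ideals.∼[]⇒InIdeal K (Gens K A) (toric⇒∼[] _ f ≤-refl f∈I))
  , toric-initial )
  , (λ u v gen → reduces⇒initial (gen⇒reduces gen))
  where open Groebner K A
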